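{- For any positive integer $s$ and any nonnegative integer $m$, $$\sum_{\substack{x_1+\dots+x_s=m\\ x_i\ge 0}}\binom{m}{x_1,\dots,x_s}T_{K_{x_1+1}}(x,y)\cdots T_{K_{x_s+1}}(x,y)=\sum_{\pi\in\mathrm{PF}(m,m+s-1)}x^{\mathrm{cm}(\pi)}y^{\mathrm{disp}(\pi)}.$$
   Context: $T_{K_N}(x,y)$ denotes the Tutte polynomial of the complete graph on $N$ vertices ($T_{K_1}=1$). For $0\le m\le n$, $\mathrm{PF}(m,n)$ is the set of sequences $\pi=(\pi_1,\dots,\pi_m)\in\{1,\dots,n\}^m$ such that, when spots $1,\dots,n$ are initially empty and for $i=1,\dots,m$ in turn car $i$ parks in the first empty spot among $\pi_i,\pi_i+1,\dots,n$, every car parks; let $\mathcal O(\pi)_i$ be the spot where car $i$ parks. The displacement is $\mathrm{disp}(\pi)=\sum_{i=1}^m(\mathcal O(\pi)_i-\pi_i)$. For a classical parking function $\tau\in\mathrm{PF}(\ell,\ell)$, an index $i$ is a critical left-to-right maximum if $\tau_s<\tau_i$ for all $s<i$ and there are exactly $\tau_i-1$ entries of $\tau$ less than $\tau_i$ and exactly $\ell-\tau_i$ entries greater than $\tau_i$; $\mathrm{cm}(\tau)$ is the number of such indices. For $\pi\in\mathrm{PF}(m,n)$, let $0=:k_0<k_1<\dots<k_{n-m}<k_{n-m+1}:=n+1$ where $k_1,\dots,k_{n-m}$ are the spots left empty. For each $0\le i\le n-m$, the subsequence of entries of $\pi$ lying strictly between $k_i$ and $k_{i+1}$ (in their original order),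 each decreased by $k_i$, is a classical parking function $\pi'_i\in\mathrm{PF}(k_{i+1}-k_i-1,k_{i+1}-k_i-1)$ (possibly empty, with $\mathrm{cm}=0$). Then $\mathrm{cm}(\pi)=\sum_{i=0}^{n-m}\mathrm{cm}(\pi'_i)$. -}

module Defs where

open import Data.Nat as ℕ using (ℕ; zero; suc; _∸_; _≤ᵇ_; _<ᵇ_; _≡ᵇ_)
open import Data.Nat.ListAction using (sum)
open import Data.Bool.ListAction using (all; any)
open import Data.Nat.Combinatorics using (_C_)
open import Data.Bool using (Bool; true; false; if_then_else_; _∧_; not)
open import Data.List using (List; []; _∷_; [_]; map; foldr; foldl; length; concatMap; _++_; allFin; upTo; zipWith; head; filterᵇ)
open import Data.Fin using (Fin; toℕ)
open import Data.Maybe using (Maybe; just; nothing; is-just)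
open import Data.Product using (_×_; _,_)
open import Function using (id)
open import Algebra.Bundles using (CommutativeRing)

subsets : ∀ {a} {A : Set a} → List A → List (List A)
subsets []       = [] ∷ []
subsets (x ∷ xs) = subsets xs ++ map (x ∷_) (subsets xs)

memᵇ : ℕ → List ℕ → Bool
memᵇ j xs = any (λ k → j ≡ᵇ k) xs

count : (ℕ → Bool) → List ℕ → ℕ
count p xs = length (filterᵇ p xs)

spots : ℕ → List ℕ
spots n = map suc (upTo n)

edgesK : (N : ℕ) → List (Fin N × Fin N)
edgesK N = concatMap (λ i → map (i ,_) (filterᵇ (λ j → toℕ i <ᵇ toℕ j) (allFin N))) (allFin N)

-- union–find style labelling: merging the classes of u and v
mergeLab : ∀ {N} → (Fin N → Fin N) → Fin N × Fin N → (Fin N → Fin N)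
mergeLab lab (u , v) w = if toℕ (lab w) ≡ᵇ toℕ (lab v) then lab u else lab w

labels : ∀ {N} → List (Fin N × Fin N) → Fin N → Fin N
labels A = foldl mergeLab id A

components : (N : ℕ) → List (Fin N × Fin N) → ℕ
components N A = length (filterᵇ (λ i → toℕ (labels A i) ≡ᵇ toℕ i) (allFin N))

rank : (N : ℕ) → List (Fin N × Fin N) → ℕ
rank N A = N ∸ components N A

multinomial : List ℕ → ℕ
multinomial []       = 1
multinomial (x ∷ xs) = ((x ℕ.+ sum xs) C x) ℕ.* multinomial xs

compositions : (s m : ℕ) → List (List ℕ)
compositions zero    m = if m ≡ᵇ 0 then [ [] ] else []
compositions (suc s) m = concatMap (λ x → map (x ∷_) (compositions s (m ∸ x))) (upTo (suc m))

parkStep : (n : ℕ) → (occupied : List ℕ) → (p : ℕ) → Maybe ℕ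
parkStep n occ p = head (filterᵇ (λ j → (p ≤ᵇ j) ∧ not (memᵇ j occ)) (spots n))

outcomeAux : (n : ℕ) → List ℕ → List ℕ → Maybe (List ℕ)
outcomeAux n occ []       = just []
outcomeAux n occ (p ∷ ps) with parkStep n occ p
... | nothing = nothing
... | just j with outcomeAux n (j ∷ occ) ps
...   | nothing = nothing
...   | just os = just (j ∷ os)

outcome : (n : ℕ) → List ℕ → Maybe (List ℕ)
outcome n π = outcomeAux n [] π

sequences : (m n : ℕ) → List (List ℕ)
sequences zero    n = [ [] ]
sequences (suc m) n = concatMap (λ p → map (p ∷_) (sequences m n)) (spots n)

PF : (m n : ℕ) → List (List ℕ)
PF m n = filterᵇ (λ π → is-just (outcome n π)) (sequences m n)

disp : (n : ℕ) → List ℕ → ℕ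
disp n π with outcome n π
... | nothing = 0
... | just os = sum (zipWith _∸_ os π)

-- critical left-to-right maxima of a classical parking function τ ∈ PF(ℓ,ℓ)
cmClassicalAux : (τ : List ℕ) → (prefix : List ℕ) → (rest : List ℕ) → ℕ
cmClassicalAux τ pre []      = 0
cmClassicalAux τ pre (t ∷ r) =
  (if all (λ u → u <ᵇ t) pre
        ∧ (count (λ u → u <ᵇ t) τ ≡ᵇ t ∸ 1)
        ∧ (count (λ u → t <ᵇ u) τ ≡ᵇ length τ ∸ t)
     then 1 else 0)
  ℕ.+ cmClassicalAux τ (pre ++ [ t ]) r

cmClassical : List ℕ → ℕ
cmClassical τ = cmClassicalAux τ [] τ

consecutive : List ℕ → List (ℕ × ℕ)
consecutive []           = []
consecutive (a ∷ [])     = []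
consecutive (a ∷ b ∷ bs) = (a , b) ∷ consecutive (b ∷ bs)

cm : (n : ℕ) → List ℕ → ℕ
cm n π with outcome n π
... | nothing = 0
... | just os =
  let empties = filterᵇ (λ j → not (memᵇ j os)) (spots n)
      bounds  = 0 ∷ (empties ++ [ suc n ])
      block : ℕ × ℕ → List ℕ
      block (a , b) = map (λ p → p ∸ a) (filterᵇ (λ p → (a <ᵇ p) ∧ (p <ᵇ b)) π)
  in sum (map (λ ab → cmClassical (block ab)) (consecutive bounds))

module RingEval {c ℓ} (R : CommutativeRing c ℓ) where
  open CommutativeRing R

  pow : Carrier → ℕ → Carrier
  pow a zero    = 1#
  pow a (suc k) = a * pow a k

  natR : ℕ → Carrier
  natR zero    = 0#
  natR (suc k) = 1# + natR k

  sumR : List Carrier → Carrier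
  sumR = foldr _+_ 0#

  prodR : List Carrier → Carrier
  prodR = foldr _*_ 1#

  tutteK : ℕ → Carrier → Carrier → Carrier
  tutteK N x y =
    sumR (map (λ A → pow (x - 1#) (rank N (edgesK N) ∸ rank N A)
                   * pow (y - 1#) (length A ∸ rank N A))
              (subsets (edgesK N)))

  tutteSide : (s m : ℕ) → Carrier → Carrier → Carrier
  tutteSide s m x y =
    sumR (map (λ xs → natR (multinomial xs) * prodR (map (λ xi → tutteK (suc xi) x y) xs))
              (compositions s m))

  parkingSide : (s m : ℕ) → Carrier → Carrier → Carrier
  parkingSide s m x y =
    sumR (map (λ π → pow x (cm (m ℕ.+ s ∸ 1) π) * pow y (disp (m ℕ.+ s ∸ 1) π))
              (PF m (m ℕ.+ s ∸ 1)))

{-# OPTIONS --safe #-}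
module Submission where

-- Scan the spots from left to right while keeping a queue: the cars preferring the current spot join the queue,
-- one queueing car parks if there is any, and the others move on. The displacement is the sum of the lengths of
-- the queues moving on, so it depends only on the multiset of preferences. Summing over the classical parking
-- functions with a cars queueing and r cars still to come gives, up to a factor y^a, a quantity G(a + 1 , r) with
--   G(0 , 0) = 1,   G(0 , r + 1) = (x − 1) G(1 , r),   G(a + 1 , r) = y^a Σ_k C(r , k) G(a + k , r − k).
-- The term (x − 1) G(1 , r) accounts for cm: when the queue is empty, a car alone in preferring the next spot is
-- critical exactly if it precedes all remaining cars, so one of its r + 1 positions has weight x instead of 1.
--
-- The Tutte polynomial of K_{n+1} is G(1 , n) too: explore the graph from a vertex, reading the edges at one
-- active vertex at a time, where a vertices are known to be connected to the explored part and r are untouched.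
-- An edge between active vertices is a loop after contraction (factor y), the edges to the untouched vertices
-- activate an arbitrary subset of them, and a new component (factor x − 1) starts when no active vertex is left.
--
-- For s > 1 both sides satisfy Q_{s+1}(m) = Σ_k C(m , k) Q_1(k) Q_s(m − k); on the parking side k + 1 is the
-- first empty spot.

open import Defs
open import Data.Nat as ℕ using (ℕ; zero; suc; pred; _∸_; _≤_; _<_; z≤n; s≤s; _≤ᵇ_; _<ᵇ_; _≡ᵇ_)
import Data.Nat.Properties as ℕ
open import Data.Nat.Combinatorics using (_C_; nCk+nC[k+1]≡[n+1]C[k+1]; k>n⇒nCk≡0)
open import Data.Nat.ListAction using (sum)
open import Data.Bool using (Bool; true; false; if_then_else_; _∧_; _∨_; not)
open import Data.Bool.ListAction using (all)
open import Data.Bool.Properties using (T-≡; ∧-comm; ∧-assoc; ∧-zeroʳ)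
open import Data.Fin as Fin using (Fin; zero; suc; toℕ)
import Data.Fin.Properties as Fin
open import Data.List using (List; []; _∷_; [_]; map; foldl; length; _++_; concatMap; upTo; zipWith; head;
  filterᵇ; allFin; tabulate; reverse; _ʳ++_)
open import Data.List.Properties using
  (map-cong; map-∘; map-id; map-++; map-upTo; upTo-∷ʳ; map-tabulate; filter-++; ++-assoc; ++-identityʳ;
    length-map; length-filter; length-tabulate)
open import Data.List.Relation.Unary.All as All using (All; []; _∷_)
import Data.List.Relation.Unary.All.Properties as All
open import Data.List.Relation.Unary.AllPairs as AllPairs using (AllPairs; []; _∷_)
import Data.List.Relation.Unary.AllPairs.Properties as AllPairs
open import Data.List.Relation.Binary.Permutation.Propositional as ↭ using (_↭_; prep; swap; ↭-sym; ↭-trans)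
import Data.List.Relation.Binary.Permutation.Propositional.Properties as ↭
open import Data.Maybe using (Maybe; just; nothing; is-just)
open import Data.Product using (_×_; _,_; proj₁)
open import Data.Empty using (⊥-elim)
open import Function using (_∘_; id; case_of_; Equivalence)
open import Relation.Nullary using (yes; no)
open import Relation.Nullary.Decidable using (T?)
open import Relation.Binary using (Symmetric)
open import Relation.Binary.PropositionalEquality as ≡ using (_≡_; _≢_; cong; cong₂; subst)
open import Algebra.Bundles using (CommutativeRing)

module Queue where
  open import Data.Nat using (_+_)
  open import Data.Nat.Properties
  open import Relation.Binary.PropositionalEquality using (refl; sym; trans; subst₂; module ≡-Reasoning)

  -- Filters and Boolean comparisons.

  module _ {a} {A : Set a} where

    filterᵇ-cong : ∀ {p q : A → Bool} → (∀ x → p x ≡ q x) → ∀ xs → filterᵇ p xs ≡ filterᵇ q xs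
    filterᵇ-cong eq [] = refl
    filterᵇ-cong {p} {q} eq (x ∷ xs) with p x | q x | eq x
    ... | true  | _ | refl = cong (x ∷_) (filterᵇ-cong eq xs)
    ... | false | _ | refl = filterᵇ-cong eq xs

    filterᵇ-∧ : ∀ (p q : A → Bool) xs → filterᵇ (λ x → p x ∧ q x) xs ≡ filterᵇ p (filterᵇ q xs)
    filterᵇ-∧ p q [] = refl
    filterᵇ-∧ p q (x ∷ xs) with q x | p x in eq
    ... | true  | true  rewrite eq = cong (x ∷_) (filterᵇ-∧ p q xs)
    ... | true  | false rewrite eq = filterᵇ-∧ p q xs
    ... | false | true  = filterᵇ-∧ p q xs
    ... | false | false = filterᵇ-∧ p q xs

    filterᵇ-map : ∀ {b} {B : Set b} (p : B → Bool) (f : A → B) xs →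
      filterᵇ p (map f xs) ≡ map f (filterᵇ (p ∘ f) xs)
    filterᵇ-map p f [] = refl
    filterᵇ-map p f (x ∷ xs) with p (f x)
    ... | true  = cong (f x ∷_) (filterᵇ-map p f xs)
    ... | false = filterᵇ-map p f xs

    filterᵇ-true : ∀ {p : A → Bool} {xs} → All (λ x → p x ≡ true) xs → filterᵇ p xs ≡ xs
    filterᵇ-true [] = refl
    filterᵇ-true (px ∷ pxs) rewrite px = cong (_ ∷_) (filterᵇ-true pxs)

    filterᵇ-false : ∀ {p : A → Bool} {xs} → All (λ x → p x ≡ false) xs → filterᵇ p xs ≡ []
    filterᵇ-false [] = refl
    filterᵇ-false (px ∷ pxs) rewrite px = filterᵇ-false pxs

    filterᵇ-↭ : ∀ (p : A → Bool) {xs ys} → xs ↭ ys → filterᵇ p xs ↭ filterᵇ p ys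
    filterᵇ-↭ p = ↭.filter-↭ (T? ∘ p)

  <⇒<ᵇ≡true : ∀ {m n} → m < n → (m <ᵇ n) ≡ true
  <⇒<ᵇ≡true lt = Equivalence.to T-≡ (<⇒<ᵇ lt)

  ≤⇒<ᵇ≡false : ∀ {m n} → n ≤ m → (m <ᵇ n) ≡ false
  ≤⇒<ᵇ≡false {m} {n} le with m <ᵇ n in eq
  ... | false = refl
  ... | true  = ⊥-elim (<⇒≱ (<ᵇ⇒< m n (Equivalence.from T-≡ eq)) le)

  ≤⇒≤ᵇ≡true : ∀ {m n} → m ≤ n → (m ≤ᵇ n) ≡ true
  ≤⇒≤ᵇ≡true le = Equivalence.to T-≡ (≤⇒≤ᵇ le)

  <⇒≤ᵇ≡false : ∀ {m n} → n < m → (m ≤ᵇ n) ≡ false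
  <⇒≤ᵇ≡false {m} {n} lt with m ≤ᵇ n in eq
  ... | false = refl
  ... | true  = ⊥-elim (<⇒≱ lt (≤ᵇ⇒≤ m n (Equivalence.from T-≡ eq)))

  ≡ᵇ-refl : ∀ n → (n ≡ᵇ n) ≡ true
  ≡ᵇ-refl n = Equivalence.to T-≡ (≡⇒≡ᵇ n n refl)

  ≢⇒≡ᵇ≡false : ∀ {m n} → m ≢ n → (m ≡ᵇ n) ≡ false
  ≢⇒≡ᵇ≡false {m} {n} ne with m ≡ᵇ n in eq
  ... | false = refl
  ... | true  = ⊥-elim (ne (≡ᵇ⇒≡ m n (Equivalence.from T-≡ eq)))

  -- Scanning the spots with a queue

  -- Two cuts are used. `lower (suc i)` with `upper i` separates the preferences up to `i` from all
  -- later ones; `lower (suc i)` with `upper (suc i)` leaves out the preference `suc i`, which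
  -- nobody has when that spot stays empty.
  lower upper : ℕ → List ℕ → List ℕ
  lower p = filterᵇ (_<ᵇ p)
  upper p w = map (_∸ p) (filterᵇ (p <ᵇ_) w)

  ones : List ℕ → ℕ
  ones w = length (lower 2 w)

  -- In overflow n a w, delay n a w and empties n a w the spots 1, …, n are scanned from left to right: a cars
  -- queue in front of spot 1 and the cars in w join the queue at their preferred spots.
  overflow : ℕ → ℕ → List ℕ → ℕ
  overflow zero    a w = a + length w
  overflow (suc n) a w = overflow n (pred (a + ones w)) (upper 1 w)

  delay : ℕ → ℕ → List ℕ → ℕ
  delay zero    a w = 0
  delay (suc n) a w = pred (a + ones w) + delay n (pred (a + ones w)) (upper 1 w)

  vacant : ℕ → List ℕ → List ℕ
  vacant zero    es = 1 ∷ es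
  vacant (suc _) es = es

  empties : ℕ → ℕ → List ℕ → List ℕ
  empties zero    a w = []
  empties (suc n) a w = vacant (a + ones w) (map suc (empties n (pred (a + ones w)) (upper 1 w)))

  empties-positive : ∀ n a w → All (1 ≤_) (empties n a w)
  empties-positive zero a w = []
  empties-positive (suc n) a w with a + ones w
  ... | zero  = s≤s z≤n ∷ All.map⁺ (All.universal (λ _ → s≤s z≤n) _)
  ... | suc b = All.map⁺ (All.universal (λ _ → s≤s z≤n) _)

  empties-sorted : ∀ n a w → AllPairs _<_ (empties n a w)
  empties-sorted zero a w = []
  empties-sorted (suc n) a w with a + ones w
  ... | zero  = All.map⁺ (All.map s≤s (empties-positive n 0 (upper 1 w)))
                ∷ AllPairs.map⁺ (AllPairs.map s≤s (empties-sorted n 0 (upper 1 w)))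
  ... | suc b = AllPairs.map⁺ (AllPairs.map s≤s (empties-sorted n b (upper 1 w)))

  length-lower-upper : ∀ w → ones w + length (upper 1 w) ≡ length w
  length-lower-upper [] = refl
  length-lower-upper (zero ∷ w) = cong suc (length-lower-upper w)
  length-lower-upper (suc zero ∷ w) = cong suc (length-lower-upper w)
  length-lower-upper (suc (suc q) ∷ w) = trans (+-suc _ _) (cong suc (length-lower-upper w))

  length-split : ∀ a {k} w → a + ones w ≡ k → a + length w ≡ k + length (upper 1 w)
  length-split a w eq = trans (cong (a +_) (sym (length-lower-upper w)))
    (trans (sym (+-assoc a _ _)) (cong (_+ length (upper 1 w)) eq))

  -- Double counting: a spot is empty or takes one car, and a car takes one spot or overflows.
  length-empties : ∀ n a w → length (empties n a w) + (a + length w) ≡ n + overflow n a w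
  length-empties zero a w = refl
  length-empties (suc n) a w with a + ones w in eq
  ... | zero = begin
    suc (length (map suc es)) + (a + length w)
      ≡⟨ cong₂ (λ k l → suc k + l) (length-map suc es) (length-split a w eq) ⟩
    suc (length es + length (upper 1 w))
      ≡⟨ cong suc (length-empties n 0 (upper 1 w)) ⟩
    suc (n + overflow n 0 (upper 1 w)) ∎
    where
    open ≡-Reasoning
    es = empties n 0 (upper 1 w)
  ... | suc b = begin
    length (map suc es) + (a + length w)
      ≡⟨ cong₂ _+_ (length-map suc es) (length-split a w eq) ⟩
    length es + suc (b + length (upper 1 w))
      ≡⟨ +-suc _ _ ⟩
    suc (length es + (b + length (upper 1 w)))
      ≡⟨ cong suc (length-empties n b (upper 1 w)) ⟩
    suc (n + overflow n b (upper 1 w)) ∎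
    where
    open ≡-Reasoning
    es = empties n b (upper 1 w)

  -- The effect of one more car on the scan.

  data Park (q : ℕ) : List ℕ → ℕ → List ℕ → Set where
    here  : ∀ {e es} → q ≤ e → Park q (e ∷ es) e es
    there : ∀ {e es j es′} → e < q → Park q es j es′ → Park q (e ∷ es) j (e ∷ es′)

  Park-suc : ∀ {q es j es′} → Park q es j es′ → Park (suc q) (map suc es) (suc j) (map suc es′)
  Park-suc (here le)    = here (s≤s le)
  Park-suc (there lt p) = there (s≤s lt) (Park-suc p)

  -- Unprimed values are those before the extra car joins the queue at spot 1. If it ends up filling
  -- spot `j`, it adds `j` - 1 to the delay; the equation is written additively to avoid truncated
  -- subtraction.
  data QueueJoin (E : List ℕ) (D X : ℕ) (E′ : List ℕ) (D′ X′ : ℕ) : Set where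
    parked : ∀ j → E ≡ j ∷ E′ → X′ ≡ X → suc D′ ≡ D + j → QueueJoin E D X E′ D′ X′
    lost   : E ≡ [] → X′ ≡ suc X → QueueJoin E D X E′ D′ X′

  -- A vacant spot 1 takes the extra car. Otherwise the spot serves one car either way, and the
  -- queue moving on is longer by one, which adds 1 to the delay and repeats the situation one spot
  -- later.
  queueJoin : ∀ n a w → QueueJoin (empties n a w) (delay n a w) (overflow n a w)
                                  (empties n (suc a) w) (delay n (suc a) w) (overflow n (suc a) w)
  queueJoin zero a w = lost refl refl
  queueJoin (suc n) a w with a + ones w
  ... | zero = parked 1 refl refl (+-comm 1 _)
  ... | suc b with queueJoin n b (upper 1 w)
  ...   | lost e x = lost (cong (map suc) e) x
  ...   | parked j e x d = parked (suc j) (cong (map suc) e) x (begin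
          suc (suc b + delay n (suc b) (upper 1 w)) ≡⟨ cong suc (sym (+-suc b _)) ⟩
          suc (b + suc (delay n (suc b) (upper 1 w))) ≡⟨ cong (λ t → suc (b + t)) d ⟩
          suc (b + (delay n b (upper 1 w) + j)) ≡⟨ cong suc (sym (+-assoc b _ j)) ⟩
          suc (b + delay n b (upper 1 w) + j) ≡⟨ sym (+-suc _ j) ⟩
          b + delay n b (upper 1 w) + suc j ∎)
          where open ≡-Reasoning

  data Arrival (q : ℕ) (E : List ℕ) (D X : ℕ) (E′ : List ℕ) (D′ X′ : ℕ) : Set where
    parked : ∀ j → Park q E j E′ → X′ ≡ X → D′ + q ≡ D + j → Arrival q E D X E′ D′ X′
    lost   : All (_< q) E → X′ ≡ suc X → Arrival q E D X E′ D′ X′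

  Park-first : ∀ {q E j E′} → E ≡ j ∷ E′ → All (q ≤_) E → Park q E j E′
  Park-first refl (le ∷ _) = here le

  -- Cars in a queue are interchangeable, so a new car changes the scan as if it drove past the
  -- others to the first empty spot from `q` on. A car preferring spot 1 joins the queue there; any
  -- other leaves spot 1 as it is and is handled by recursion.
  arrival : ∀ n a q w → 1 ≤ q →
    Arrival q (empties n a w) (delay n a w) (overflow n a w)
              (empties n a (q ∷ w)) (delay n a (q ∷ w)) (overflow n a (q ∷ w))
  arrival zero a q w _ = lost [] (+-suc a _)
  arrival (suc n) a (suc zero) w _ rewrite +-suc a (ones w) with queueJoin (suc n) a w | empties-positive
    (suc n) a w
  ... | parked j e x d | pos = parked j (Park-first e pos) x (trans (+-comm _ 1) d)
  ... | lost e x | _ = lost (subst (All (_< 1)) (sym e) []) x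
  arrival (suc n) a (suc (suc q)) w _ with a + ones w | arrival n (pred (a + ones w)) (suc q) (upper 1 w)
    (s≤s z≤n)
  ... | zero | lost es x = lost (s≤s (s≤s z≤n) ∷ All.map⁺ (All.map s≤s es)) x
  ... | zero | parked j p x d = parked (suc j) (there (s≤s (s≤s z≤n)) (Park-suc p)) x
                                  (trans (+-suc _ (suc q)) (trans (cong suc d) (sym (+-suc _ j))))
  ... | suc b | lost es x = lost (All.map⁺ (All.map s≤s es)) x
  ... | suc b | parked j p x d = parked (suc j) (Park-suc p) x (begin
          b + delay n b (suc q ∷ upper 1 w) + suc (suc q) ≡⟨ +-suc _ (suc q) ⟩
          suc (b + delay n b (suc q ∷ upper 1 w) + suc q) ≡⟨ cong suc (+-assoc b _ _) ⟩
          suc (b + (delay n b (suc q ∷ upper 1 w) + suc q)) ≡⟨ cong (λ t → suc (b + t)) d ⟩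
          suc (b + (delay n b (upper 1 w) + j)) ≡⟨ cong suc (sym (+-assoc b _ j)) ⟩
          suc (b + delay n b (upper 1 w) + j) ≡⟨ sym (+-suc _ j) ⟩
          b + delay n b (upper 1 w) + suc j ∎)
          where open ≡-Reasoning

  Park-head : ∀ {q E j E′} → Park q E j E′ → head (filterᵇ (q ≤ᵇ_) E) ≡ just j
  Park-head (here le) rewrite ≤⇒≤ᵇ≡true le = refl
  Park-head (there lt p) rewrite <⇒≤ᵇ≡false lt = Park-head p

  Park-≤ : ∀ {q E j E′} → Park q E j E′ → q ≤ j
  Park-≤ (here le) = le
  Park-≤ (there _ p) = Park-≤ p

  Park-remaining : ∀ {q E j E′} → AllPairs _<_ E → Park q E j E′ → filterᵇ (λ e → not (e ≡ᵇ j)) E ≡ E′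
  Park-remaining {j = j} (lts ∷ _) (here _) rewrite ≡ᵇ-refl j =
    filterᵇ-true (All.map (λ lt → cong not (≢⇒≡ᵇ≡false (<⇒≢ lt ∘ sym))) lts)
  Park-remaining (_ ∷ sorted) (there lt p) rewrite ≢⇒≡ᵇ≡false (<⇒≢ (<-≤-trans lt (Park-≤ p))) =
    cong (_ ∷_) (Park-remaining sorted p)

  ones-↭ : ∀ {v w} → v ↭ w → ones v ≡ ones w
  ones-↭ p = ↭.↭-length (filterᵇ-↭ _ p)

  upper-↭ : ∀ p {v w} → v ↭ w → upper p v ↭ upper p w
  upper-↭ p e = ↭.map⁺ _ (filterᵇ-↭ _ e)

  -- The scan sees only how many cars prefer each spot, so the order of arrival is irrelevant to it;
  -- likewise for `delay` and `empties`.
  overflow-↭ : ∀ n a {v w} → v ↭ w → overflow n a v ≡ overflow n a w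
  overflow-↭ zero a p = cong (a +_) (↭.↭-length p)
  overflow-↭ (suc n) a {v} p rewrite sym (ones-↭ p) = overflow-↭ n _ (upper-↭ 1 p)

  delay-↭ : ∀ n a {v w} → v ↭ w → delay n a v ≡ delay n a w
  delay-↭ zero a p = refl
  delay-↭ (suc n) a p rewrite sym (ones-↭ p) = cong (_ +_) (delay-↭ n _ (upper-↭ 1 p))

  empties-↭ : ∀ n a {v w} → v ↭ w → empties n a v ≡ empties n a w
  empties-↭ zero a p = refl
  empties-↭ (suc n) a {v} p rewrite sym (ones-↭ p) =
    cong (vacant (a + ones v) ∘ map suc) (empties-↭ n _ (upper-↭ 1 p))

  overflow-grows : ∀ n a v w → All (1 ≤_) v → overflow n a w ≤ overflow n a (v ʳ++ w)
  overflow-grows n a [] w [] = ≤-refl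
  overflow-grows n a (q ∷ v) w (pos ∷ ps) = ≤-trans step (overflow-grows n a v (q ∷ w) ps)
    where
    step : overflow n a w ≤ overflow n a (q ∷ w)
    step with arrival n a q w pos
    ... | parked _ _ x _ = ≤-reflexive (sym x)
    ... | lost _ x = ≤-trans (n≤1+n _) (≤-reflexive (sym x))

  -- Agreement of the scan with the parking procedure.

  not-∨ : ∀ a b → not (a ∨ b) ≡ not a ∧ not b
  not-∨ true  b = refl
  not-∨ false b = refl

  free : List ℕ → ℕ → Bool
  free os e = not (memᵇ e os)

  data Outcome (n : ℕ) (v w ps : List ℕ) : Maybe (List ℕ) → Set where
    failed    : overflow n 0 w ≢ 0 → Outcome n v w ps nothing
    succeeded : ∀ os → overflow n 0 w ≡ 0 → filterᵇ (free os) (empties n 0 v) ≡ empties n 0 w →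
                delay n 0 w ≡ delay n 0 v + sum (zipWith _∸_ os ps) → Outcome n v w ps (just os)

  -- Induction on the cars still to park. `v` holds the parked ones, latest first, whence the
  -- reversed append. The invariant identifies the free spots with the vacant spots of the scan of
  -- `v`, so each search of `parkStep` is one `arrival`.
  outcomeAux-spec : ∀ n occ v ps → All (1 ≤_) ps → filterᵇ (free occ) (spots n) ≡ empties n 0 v →
    overflow n 0 v ≡ 0 → Outcome n v (ps ʳ++ v) ps (outcomeAux n occ ps)
  outcomeAux-spec n occ v [] [] inv ok =
    succeeded [] ok (filterᵇ-true (All.universal (λ _ → refl) _)) (sym (+-identityʳ _))
  outcomeAux-spec n occ v (q ∷ ps) (pos ∷ poss) inv ok
    with arrival n 0 q v pos | filterᵇ-∧ (q ≤ᵇ_) (free occ) (spots n)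
  -- No free spot is left from `q` on. The scan overflows already, and by `overflow-grows` later
  -- cars cannot repair this.
  ... | lost es x | eq rewrite eq | inv | filterᵇ-false (All.map <⇒≤ᵇ≡false es) =
    failed (λ z → case subst₂ _≤_ x z (overflow-grows n 0 ps (q ∷ v) poss) of λ ())
  ... | parked j p x d | eq rewrite eq | inv | Park-head p
    with outcomeAux n (j ∷ occ) ps
       | outcomeAux-spec n (j ∷ occ) (q ∷ v) ps poss inv′ (trans x ok)
    where
    inv′ : filterᵇ (free (j ∷ occ)) (spots n) ≡ empties n 0 (q ∷ v)
    inv′ = begin
      filterᵇ (free (j ∷ occ)) (spots n) ≡⟨ filterᵇ-cong (λ e → not-∨ (e ≡ᵇ j) (memᵇ e occ)) (spots n) ⟩
      filterᵇ (λ e → not (e ≡ᵇ j) ∧ free occ e) (spots n) ≡⟨ filterᵇ-∧ _ _ (spots n) ⟩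
      filterᵇ (λ e → not (e ≡ᵇ j)) (filterᵇ (free occ) (spots n)) ≡⟨ cong (filterᵇ _) inv ⟩
      filterᵇ (λ e → not (e ≡ᵇ j)) (empties n 0 v) ≡⟨ Park-remaining (empties-sorted n 0 v) p ⟩
      empties n 0 (q ∷ v) ∎
      where open ≡-Reasoning
  ... | nothing | failed z = failed z
  ... | just os | succeeded .os z es dd = succeeded (j ∷ os) z es′ dd′
    where
    open ≡-Reasoning
    D = delay n 0 v
    es′ : filterᵇ (free (j ∷ os)) (empties n 0 v) ≡ empties n 0 (ps ʳ++ (q ∷ v))
    es′ = begin
      filterᵇ (free (j ∷ os)) (empties n 0 v)
        ≡⟨ filterᵇ-cong (λ e → trans (not-∨ (e ≡ᵇ j) _) (∧-comm _ (free os e))) (empties n 0 v) ⟩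
      filterᵇ (λ e → free os e ∧ not (e ≡ᵇ j)) (empties n 0 v) ≡⟨ filterᵇ-∧ _ _ (empties n 0 v) ⟩
      filterᵇ (free os) (filterᵇ (λ e → not (e ≡ᵇ j)) (empties n 0 v))
        ≡⟨ cong (filterᵇ _) (Park-remaining (empties-sorted n 0 v) p) ⟩
      filterᵇ (free os) (empties n 0 (q ∷ v)) ≡⟨ es ⟩
      empties n 0 (ps ʳ++ (q ∷ v)) ∎
    moved : delay n 0 (q ∷ v) ≡ D + (j ∸ q)
    moved = +-cancelʳ-≡ q _ _ (begin
      delay n 0 (q ∷ v) + q ≡⟨ d ⟩
      D + j ≡⟨ cong (D +_) (sym (m∸n+n≡m (Park-≤ p))) ⟩
      D + (j ∸ q + q) ≡⟨ sym (+-assoc D _ q) ⟩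
      D + (j ∸ q) + q ∎)
    dd′ : delay n 0 (ps ʳ++ (q ∷ v)) ≡ D + ((j ∸ q) + sum (zipWith _∸_ os ps))
    dd′ = trans dd (trans (cong (_+ sum (zipWith _∸_ os ps)) moved) (+-assoc D _ _))

  overflow-[] : ∀ n → overflow n 0 [] ≡ 0
  overflow-[] zero = refl
  overflow-[] (suc n) = overflow-[] n

  delay-[] : ∀ n → delay n 0 [] ≡ 0
  delay-[] zero = refl
  delay-[] (suc n) = delay-[] n

  spots-suc : ∀ n → spots (suc n) ≡ 1 ∷ map suc (spots n)
  spots-suc n = cong (1 ∷_) (cong (map suc) (sym (map-upTo suc n)))

  empties-[] : ∀ n → empties n 0 [] ≡ spots n
  empties-[] zero = refl
  empties-[] (suc n) = trans (cong (λ es → 1 ∷ map suc es) (empties-[] n)) (sym (spots-suc n))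

  block : List ℕ → ℕ × ℕ → List ℕ
  block π (a , b) = map (λ p → p ∸ a) (filterᵇ (λ p → (a <ᵇ p) ∧ (p <ᵇ b)) π)

  blockCm : ℕ → List ℕ → List ℕ → ℕ
  blockCm n es π = sum (map (λ ab → cmClassical (block π ab)) (consecutive (0 ∷ (es ++ [ suc n ]))))

  module _ (n : ℕ) (π : List ℕ) (positive : All (1 ≤_) π) where

    outcome-spec : Outcome n [] (reverse π) π (outcome n π)
    outcome-spec = outcomeAux-spec n [] [] π positive
      (trans (filterᵇ-true (All.universal (λ _ → refl) _)) (sym (empties-[] n))) (overflow-[] n)

    is-just-outcome : is-just (outcome n π) ≡ (overflow n 0 π ≡ᵇ 0)
    is-just-outcome with outcome n π | outcome-spec
    ... | nothing | failed ne = sym (≢⇒≡ᵇ≡false (ne ∘ trans (overflow-↭ n 0 (↭.↭-reverse π))))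
    ... | just _  | succeeded _ z _ _ rewrite trans (sym (overflow-↭ n 0 (↭.↭-reverse π))) z = refl

    disp-delay : overflow n 0 π ≡ 0 → disp n π ≡ delay n 0 π
    disp-delay z with outcome n π | outcome-spec
    ... | nothing | failed ne = ⊥-elim (ne (trans (overflow-↭ n 0 (↭.↭-reverse π)) z))
    ... | just os | succeeded _ _ _ d = sym (begin
      delay n 0 π ≡⟨ sym (delay-↭ n 0 (↭.↭-reverse π)) ⟩
      delay n 0 (reverse π) ≡⟨ d ⟩
      delay n 0 [] + sum (zipWith _∸_ os π) ≡⟨ cong (_+ sum (zipWith _∸_ os π)) (delay-[] n) ⟩
      sum (zipWith _∸_ os π) ∎)
      where open ≡-Reasoning

    cm-blocks : overflow n 0 π ≡ 0 → cm n π ≡ blockCm n (empties n 0 π) π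
    cm-blocks z with outcome n π | outcome-spec
    ... | nothing | failed ne = ⊥-elim (ne (trans (overflow-↭ n 0 (↭.↭-reverse π)) z))
    ... | just os | succeeded _ _ es _ = cong (λ es → blockCm n es π) (begin
      filterᵇ (free os) (spots n) ≡⟨ cong (filterᵇ (free os)) (sym (empties-[] n)) ⟩
      filterᵇ (free os) (empties n 0 []) ≡⟨ es ⟩
      empties n 0 (reverse π) ≡⟨ empties-↭ n 0 (↭.↭-reverse π) ⟩
      empties n 0 π ∎)
      where open ≡-Reasoning

  -- Critical left-to-right maxima

  -- The test `good` is separated from the word, since it has to be replaced by an equivalent test
  -- when the spots are shifted.
  records : (ℕ → Bool) → List ℕ → List ℕ → ℕ
  records good pre []      = 0
  records good pre (t ∷ r) = (if all (_<ᵇ t) pre ∧ good t then 1 else 0) + records good (pre ++ [ t ]) r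

  -- The a cars queueing in front of spot 1 count as entries smaller than t.
  critical : ℕ → List ℕ → ℕ → Bool
  critical a τ t = (a + count (_<ᵇ t) τ ≡ᵇ t ∸ 1) ∧ (count (t <ᵇ_) τ ≡ᵇ (a + length τ) ∸ t)

  queueCm : ℕ → List ℕ → ℕ
  queueCm a τ = records (critical a τ) [] τ

  cmClassical-queueCm : ∀ τ → cmClassical τ ≡ queueCm 0 τ
  cmClassical-queueCm τ = go [] τ
    where
    go : ∀ pre r → cmClassicalAux τ pre r ≡ records (critical 0 τ) pre r
    go pre []      = refl
    go pre (t ∷ r) = cong (_ +_) (go (pre ++ [ t ]) r)

  all-++ : ∀ (p : ℕ → Bool) xs ys → all p (xs ++ ys) ≡ all p xs ∧ all p ys
  all-++ p []       ys = refl
  all-++ p (x ∷ xs) ys = trans (cong (p x ∧_) (all-++ p xs ys)) (sym (∧-assoc (p x) _ _))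

  upper-++ : ∀ p v w → upper p (v ++ w) ≡ upper p v ++ upper p w
  upper-++ p v w = trans (cong (map _) (filter-++ (T? ∘ (p <ᵇ_)) v w)) (map-++ _ (filterᵇ (p <ᵇ_) v) _)

  all-upper : ∀ t w → all (_<ᵇ suc (suc t)) w ≡ all (_<ᵇ suc t) (upper 1 w)
  all-upper t [] = refl
  all-upper t (zero ∷ w) = all-upper t w
  all-upper t (suc zero ∷ w) = all-upper t w
  all-upper t (suc (suc q) ∷ w) = cong (_ ∧_) (all-upper t w)

  count-<-upper : ∀ t w → count (_<ᵇ suc (suc t)) w ≡ ones w + count (_<ᵇ suc t) (upper 1 w)
  count-<-upper t [] = refl
  count-<-upper t (zero ∷ w) = cong suc (count-<-upper t w)
  count-<-upper t (suc zero ∷ w) = cong suc (count-<-upper t w)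
  count-<-upper t (suc (suc q) ∷ w) with q <ᵇ t
  ... | true  = trans (cong suc (count-<-upper t w)) (sym (+-suc (ones w) _))
  ... | false = count-<-upper t w

  count->-upper : ∀ t w → count (suc (suc t) <ᵇ_) w ≡ count (suc t <ᵇ_) (upper 1 w)
  count->-upper t [] = refl
  count->-upper t (zero ∷ w) = count->-upper t w
  count->-upper t (suc zero ∷ w) = count->-upper t w
  count->-upper t (suc (suc q) ∷ w) with t <ᵇ q
  ... | true  = cong suc (count->-upper t w)
  ... | false = count->-upper t w

  -- Of the `suc b` cars at spot 1 one parks and `b` move on. All of them count as smaller than the
  -- entry, so the number of smaller entries and the required value both drop by one.
  critical-upper : ∀ a b τ t → a + ones τ ≡ suc b →
    critical a τ (suc (suc t)) ≡ critical b (upper 1 τ) (suc t)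
  critical-upper a b τ t eq = cong₂ _∧_
    (cong (_≡ᵇ suc t) (trans (cong (a +_) (count-<-upper t τ))
      (trans (sym (+-assoc a _ _)) (cong (_+ count (_<ᵇ suc t) (upper 1 τ)) eq))))
    (cong₂ _≡ᵇ_ (count->-upper t τ) (cong (_∸ suc (suc t)) (length-split a τ eq)))

  -- Entries 1 can be deleted: they never stop a larger entry from being a left-to-right maximum,
  -- and the last hypothesis says that they do not count themselves. That hypothesis persists, since
  -- a positive entry in the prefix excludes 1 as a new maximum.
  records-upper : ∀ {good good′} pre rest → All (1 ≤_) rest →
    (∀ t → good (suc (suc t)) ≡ good′ (suc t)) → all (_<ᵇ 1) pre ∧ good 1 ≡ false →
    records good pre rest ≡ records good′ (upper 1 pre) (upper 1 rest)
  records-upper pre [] _ _ _ = refl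
  records-upper {good} {good′} pre (suc zero ∷ r) (_ ∷ pos) shift hidden rewrite hidden =
    trans (records-upper {good} {good′} (pre ++ [ 1 ]) r pos shift hidden′)
      (cong (λ z → records good′ z (upper 1 r)) (trans (upper-++ 1 pre [ 1 ]) (++-identityʳ _)))
    where
    hidden′ : all (_<ᵇ 1) (pre ++ [ 1 ]) ∧ good 1 ≡ false
    hidden′ = cong (_∧ good 1) (trans (all-++ _ pre [ 1 ]) (∧-zeroʳ _))
  records-upper {good} {good′} pre (suc (suc t) ∷ r) (_ ∷ pos) shift hidden = cong₂ _+_
    (cong (if_then 1 else 0) (cong₂ _∧_ (all-upper t pre) (shift t)))
    (trans (records-upper {good} {good′} (pre ++ [ suc (suc t) ]) r pos shift hidden′)
      (cong (λ z → records good′ z (upper 1 r)) (upper-++ 1 pre [ suc (suc t) ])))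
    where
    hidden′ : all (_<ᵇ 1) (pre ++ [ suc (suc t) ]) ∧ good 1 ≡ false
    hidden′ = cong (_∧ good 1) (trans (all-++ _ pre [ suc (suc t) ]) (∧-zeroʳ _))

  -- With a car waiting in front of spot 1, an entry 1 has something smaller and is not critical.
  queueCm-suc : ∀ a τ → All (1 ≤_) τ → queueCm (suc a) τ ≡ queueCm (a + ones τ) (upper 1 τ)
  queueCm-suc a τ pos = records-upper [] τ pos (λ t → critical-upper (suc a) _ τ t refl) refl

  count-<1 : ∀ {w} → All (1 ≤_) w → count (_<ᵇ 1) w ≡ 0
  count-<1 [] = refl
  count-<1 (s≤s _ ∷ pos) = count-<1 pos

  m≡ᵇn+m : ∀ n m → (m ≡ᵇ n + m) ≡ (n ≡ᵇ 0)
  m≡ᵇn+m zero m = ≡ᵇ-refl m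
  m≡ᵇn+m (suc n) m = ≢⇒≡ᵇ≡false (m≢1+n+m m)

  -- An entry 1 is a left-to-right maximum only in first position, and it is critical there only if
  -- all other entries are larger, that is, if it is the only 1.
  queueCm-zero : ∀ q τ b → All (1 ≤_) (q ∷ τ) → ones (q ∷ τ) ≡ suc b →
    queueCm 0 (q ∷ τ) ≡ (if (q ≡ᵇ 1) ∧ (ones τ ≡ᵇ 0) then 1 else 0) + queueCm b (upper 1 (q ∷ τ))
  queueCm-zero (suc zero) τ b (_ ∷ pos) refl = cong₂ _+_
    (cong (if_then 1 else 0) (cong₂ _∧_ (cong (_≡ᵇ 0) (count-<1 pos)) (begin
      (count (1 <ᵇ_) τ ≡ᵇ length τ)
        ≡⟨ cong₂ _≡ᵇ_ (sym (length-map _ (filterᵇ (1 <ᵇ_) τ))) (sym (length-lower-upper τ)) ⟩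
      (length (upper 1 τ) ≡ᵇ ones τ + length (upper 1 τ)) ≡⟨ m≡ᵇn+m (ones τ) (length (upper 1 τ)) ⟩
      (ones τ ≡ᵇ 0) ∎)))
    (records-upper [ 1 ] τ pos (λ t → critical-upper 0 (ones τ) (1 ∷ τ) t refl) refl)
    where open ≡-Reasoning
  queueCm-zero (suc (suc q)) τ b (_ ∷ pos) eq = cong₂ _+_
    (cong (if_then 1 else 0) (critical-upper 0 b (suc (suc q) ∷ τ) q eq))
    (records-upper [ suc (suc q) ] τ pos (λ t → critical-upper 0 b (suc (suc q) ∷ τ) t eq) refl)

  -- The first empty spot

  -- Whether the spots 1, …, i are occupied and spot i + 1 is empty.
  fills : ℕ → ℕ → List ℕ → Bool
  fills zero    a w = a + ones w ≡ᵇ 0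
  fills (suc i) a w = not (a + ones w ≡ᵇ 0) ∧ fills i (pred (a + ones w)) (upper 1 w)

  ones-lower : ∀ i w → ones (lower (suc (suc i)) w) ≡ ones w
  ones-lower i [] = refl
  ones-lower i (zero ∷ w) = cong suc (ones-lower i w)
  ones-lower i (suc zero ∷ w) = cong suc (ones-lower i w)
  ones-lower i (suc (suc q) ∷ w) with q <ᵇ i
  ... | true  = ones-lower i w
  ... | false = ones-lower i w

  upper-lower : ∀ i w → upper 1 (lower (suc (suc i)) w) ≡ lower (suc i) (upper 1 w)
  upper-lower i [] = refl
  upper-lower i (zero ∷ w) = upper-lower i w
  upper-lower i (suc zero ∷ w) = upper-lower i w
  upper-lower i (suc (suc q) ∷ w) with q <ᵇ i
  ... | true  = cong (suc q ∷_) (upper-lower i w)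
  ... | false = upper-lower i w

  upper-upper : ∀ i w → upper (suc i) w ≡ upper i (upper 1 w)
  upper-upper i [] = refl
  upper-upper zero (zero ∷ w) = upper-upper zero w
  upper-upper zero (suc zero ∷ w) = upper-upper zero w
  upper-upper zero (suc (suc q) ∷ w) = cong (_ ∷_) (upper-upper zero w)
  upper-upper (suc i) (zero ∷ w) = upper-upper (suc i) w
  upper-upper (suc i) (suc zero ∷ w) = upper-upper (suc i) w
  upper-upper (suc i) (suc (suc q) ∷ w) with i <ᵇ q
  ... | true  = cong (_ ∷_) (upper-upper (suc i) w)
  ... | false = upper-upper (suc i) w

  upper-0 : ∀ {w} → All (1 ≤_) w → upper 0 w ≡ w
  upper-0 [] = refl
  upper-0 (s≤s _ ∷ pos) = cong (_ ∷_) (upper-0 pos)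

  upper-positive : ∀ p w → All (1 ≤_) (upper p w)
  upper-positive p [] = []
  upper-positive p (q ∷ w) with p <ᵇ q in eq
  ... | true  = m<n⇒0<n∸m (<ᵇ⇒< p q (Equivalence.from T-≡ eq)) ∷ upper-positive p w
  ... | false = upper-positive p w

  upper-upper′ : ∀ i {w} → All (1 ≤_) w → upper (suc i) w ≡ upper 1 (upper i w)
  upper-upper′ zero        pos = cong (upper 1) (sym (upper-0 pos))
  upper-upper′ (suc i) {w} pos = begin
    upper (suc (suc i)) w ≡⟨ upper-upper (suc i) w ⟩
    upper (suc i) (upper 1 w) ≡⟨ upper-upper′ i (upper-positive 1 w) ⟩
    upper 1 (upper i (upper 1 w)) ≡⟨ cong (upper 1) (sym (upper-upper i w)) ⟩
    upper 1 (upper (suc i) w) ∎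
    where open ≡-Reasoning

  lower-1 : ∀ {w} → All (1 ≤_) w → lower 1 w ≡ []
  lower-1 [] = refl
  lower-1 (s≤s _ ∷ pos) = lower-1 pos

  -- The first `i` spots fill up exactly if the cars preferring them, with the queue, are `i` in
  -- number and do not overflow; spot `suc i` then stays empty if nobody prefers it. The first
  -- conditions concern `lower (suc i) w` only and the last `upper i w` only, so that sums over
  -- words factor.
  fills-spec : ∀ i a w → All (1 ≤_) w →
    fills i a w ≡ ((overflow i a (lower (suc i) w) ≡ᵇ 0) ∧ (a + length (lower (suc i) w) ≡ᵇ i)) ∧
      (ones (upper i w) ≡ᵇ 0)
  fills-spec zero a w pos rewrite lower-1 pos | upper-0 pos | +-identityʳ a with a
  ... | zero  = refl
  ... | suc _ = refl
  fills-spec (suc i) a w pos rewrite ones-lower i w | upper-lower i w | upper-upper i w with a + ones w in eq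
  ... | suc b = trans (fills-spec i b (upper 1 w) (upper-positive 1 w))
    (cong (λ l → ((overflow i b (lower (suc i) (upper 1 w)) ≡ᵇ 0) ∧ l) ∧ (ones (upper i (upper 1 w)) ≡ᵇ 0))
      (cong (_≡ᵇ suc i) (sym (trans (length-split a l (trans (cong (a +_) (ones-lower i w)) eq))
        (cong (λ u → suc b + length u) (upper-lower i w))))))
    where l = lower (suc (suc i)) w
  ... | zero with overflow i 0 (lower (suc i) (upper 1 w)) in over
  ...   | suc _ = refl
  -- Spot 1 is empty here, so the cars of `l` would have to fit, `suc i` of them, into the `i` spots
  -- of the scan of `u`.
  ...   | zero = sym (cong (_∧ (ones (upper i (upper 1 w)) ≡ᵇ 0)) (≢⇒≡ᵇ≡false λ full → 1+n≰n (begin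
            suc i ≡⟨ sym full ⟩
            a + length l ≡⟨ cong (a +_) (sym (length-lower-upper l)) ⟩
            a + (ones l + length (upper 1 l)) ≡⟨ sym (+-assoc a _ _) ⟩
            a + ones l + length (upper 1 l)
              ≡⟨ cong₂ (λ x u → x + length u) (trans (cong (a +_) (ones-lower i w)) eq) (upper-lower i w) ⟩
            length u ≤⟨ m≤n+m _ _ ⟩
            length (empties i 0 u) + length u ≡⟨ length-empties i 0 u ⟩
            i + overflow i 0 u ≡⟨ cong (i +_) over ⟩
            i + 0 ≡⟨ +-identityʳ i ⟩
            i ∎)))
    where
    open ≤-Reasoning
    l = lower (suc (suc i)) w
    u = lower (suc i) (upper 1 w)

  -- No car moves on from the empty spot `suc i`, so the scan starts afresh behind it with an empty
  -- queue. The same holds for `overflow` and `delay` below.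
  empties-split : ∀ i n a w → fills i a w ≡ true →
    empties (i + suc n) a w ≡ suc i ∷ map (suc i +_) (empties n 0 (upper (suc i) w))
  empties-split zero n a w f with a + ones w
  ... | zero = refl
  empties-split (suc i) n a w f with a + ones w
  ... | suc b rewrite upper-upper (suc i) w = trans (cong (map suc) (empties-split i n b (upper 1 w) f))
    (cong (suc (suc i) ∷_) (sym (map-∘ _)))

  overflow-split : ∀ i n a w → fills i a w ≡ true → overflow (i + suc n) a w ≡ overflow n 0 (upper (suc i) w)
  overflow-split zero n a w f with a + ones w
  ... | zero = refl
  overflow-split (suc i) n a w f with a + ones w
  ... | suc b rewrite upper-upper (suc i) w = overflow-split i n b (upper 1 w) f

  delay-split : ∀ i n a w → fills i a w ≡ true →
    delay (i + suc n) a w ≡ delay i a (lower (suc i) w) + delay n 0 (upper (suc i) w)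
  delay-split zero n a w f with a + ones w
  ... | zero = refl
  delay-split (suc i) n a w f rewrite ones-lower i w | upper-lower i w with a + ones w
  ... | suc b rewrite upper-upper (suc i) w =
    trans (cong (b +_) (delay-split i n b (upper 1 w) f)) (sym (+-assoc b _ _))

  -- Blocks between consecutive empty spots.

  consecutive-map : ∀ (f : ℕ → ℕ) xs → consecutive (map f xs) ≡ map (λ (a , b) → f a , f b) (consecutive xs)
  consecutive-map f [] = refl
  consecutive-map f (x ∷ []) = refl
  consecutive-map f (x ∷ y ∷ xs) = cong (_ ∷_) (consecutive-map f (y ∷ xs))

  block-lower : ∀ p {w} → All (1 ≤_) w → block w (0 , p) ≡ lower p w
  block-lower p [] = refl
  block-lower p {q ∷ w} (s≤s _ ∷ pos) with q <ᵇ p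
  ... | true  = cong (q ∷_) (block-lower p pos)
  ... | false = block-lower p pos

  <ᵇ-∸ : ∀ p a q → (p + a <ᵇ q) ≡ (a <ᵇ q ∸ p)
  <ᵇ-∸ zero a q = refl
  <ᵇ-∸ (suc p) zero zero = refl
  <ᵇ-∸ (suc p) (suc a) zero = refl
  <ᵇ-∸ (suc p) a (suc q) = <ᵇ-∸ p a q

  ∸-<ᵇ : ∀ p b q → p ≤ q → (q <ᵇ p + b) ≡ (q ∸ p <ᵇ b)
  ∸-<ᵇ zero b q _ = refl
  ∸-<ᵇ (suc p) b (suc q) (s≤s le) = ∸-<ᵇ p b q le

  block-upper : ∀ p a b w → block w (p + a , p + b) ≡ block (upper p w) (a , b)
  block-upper p a b [] = refl
  block-upper p a b (q ∷ w) with p <ᵇ q in lt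
  ... | true rewrite <ᵇ-∸ p a q | ∸-<ᵇ p b q (<⇒≤ (<ᵇ⇒< p q (Equivalence.from T-≡ lt)))
    with (a <ᵇ q ∸ p) ∧ (q ∸ p <ᵇ b)
  ...   | true  = cong₂ _∷_ (sym (∸-+-assoc q p a)) (block-upper p a b w)
  ...   | false = block-upper p a b w
  block-upper p a b (q ∷ w) | false rewrite ≤⇒<ᵇ≡false {p + a} {q}
    (≤-trans (≮⇒≥ λ l → case trans (sym lt) (<⇒<ᵇ≡true l) of λ ()) (m≤m+n p a)) =
    block-upper p a b w

  blockCm-split : ∀ i n es w → All (1 ≤_) w →
    blockCm (i + suc n) (suc i ∷ map (suc i +_) es) w ≡ cmClassical (lower (suc i) w) +
      blockCm n es (upper (suc i) w)
  blockCm-split i n es w pos = cong₂ _+_ (cong cmClassical (block-lower (suc i) pos)) (cong sum (begin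
    map f (consecutive (suc i ∷ map (suc i +_) es ++ [ suc (i + suc n) ]))
      -- Writing the bound `suc i` as `suc i + 0` makes the whole list of bounds a translate of the
      -- list for the `n` spots behind.
      ≡⟨ cong (map f ∘ consecutive) (cong₂ _∷_ (sym (+-identityʳ (suc i)))
        (sym (map-++ (suc i +_) es [ suc n ]))) ⟩
    map f (consecutive (map (suc i +_) (0 ∷ es ++ [ suc n ])))
      ≡⟨ cong (map f) (consecutive-map (suc i +_) (0 ∷ es ++ [ suc n ])) ⟩
    map f (map _ (consecutive (0 ∷ es ++ [ suc n ]))) ≡⟨ sym (map-∘ (consecutive (0 ∷ es ++ [ suc n ]))) ⟩
    map _ (consecutive (0 ∷ es ++ [ suc n ]))
      ≡⟨ map-cong (λ (a , b) → cong cmClassical (block-upper (suc i) a b w))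
        (consecutive (0 ∷ es ++ [ suc n ])) ⟩
    map (λ ab → cmClassical (block (upper (suc i) w) ab)) (consecutive (0 ∷ es ++ [ suc n ])) ∎))
    where
    open ≡-Reasoning
    f : ℕ × ℕ → ℕ
    f ab = cmClassical (block w ab)

open Queue

upTo-suc : ∀ n → upTo (suc n) ≡ 0 ∷ map suc (upTo n)
upTo-suc n = cong (0 ∷_) (≡.sym (map-upTo suc n))

upTo-< : ∀ n → All (_< n) (upTo n)
upTo-< n = All.applyUpTo⁺₁ id n id

-- Sums over words

-- `sequences` over an arbitrary alphabet, which can then be cut in two and relabelled.
words : ∀ {a} {A : Set a} → ℕ → List A → List (List A)
words zero    Γ = [ [] ]
words (suc m) Γ = concatMap (λ p → map (p ∷_) (words m Γ)) Γ

words-spots : ∀ m n → sequences m n ≡ words m (spots n)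
words-spots zero    n = ≡.refl
words-spots (suc m) n = cong (λ ws → concatMap (λ p → map (p ∷_) ws) (spots n)) (words-spots m n)

module _ {a p} {A : Set a} {P : A → Set p} where

  words-All : ∀ {Γ} → All P Γ → ∀ m → All (All P) (words m Γ)
  words-All all zero    = [] ∷ []
  words-All all (suc m) = All.concat⁺
    (All.map⁺ (All.map (λ pa → All.map⁺ (All.map (pa ∷_) (words-All all m))) all))

words-length : ∀ {a} {A : Set a} (Γ : List A) m → All (λ w → length w ≡ m) (words m Γ)
words-length Γ zero    = ≡.refl ∷ []
words-length Γ (suc m) = All.concat⁺
  (All.map⁺ (All.universal (λ a → All.map⁺ (All.map (cong suc) (words-length Γ m))) Γ))

spots-range : ∀ n → All (λ q → 1 ≤ q × q ≤ n) (spots n)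
spots-range n = All.map⁺ (All.map (λ lt → s≤s z≤n , lt) (upTo-< n))

words-range : ∀ m n → All (All (λ q → 1 ≤ q × q ≤ n)) (words m (spots n))
words-range m n = words-All (spots-range n) m

words-positive : ∀ m n → All (All (1 ≤_)) (words m (spots n))
words-positive m n = All.map (All.map proj₁) (words-range m n)

spots-+ : ∀ i n → spots (i ℕ.+ n) ≡ spots i ++ map (i ℕ.+_) (spots n)
spots-+ zero    n = ≡.sym (map-id (spots n))
spots-+ (suc i) n = begin
  spots (suc (i ℕ.+ n)) ≡⟨ spots-suc (i ℕ.+ n) ⟩
  1 ∷ map suc (spots (i ℕ.+ n)) ≡⟨ cong (λ l → 1 ∷ map suc l) (spots-+ i n) ⟩
  1 ∷ map suc (spots i ++ map (i ℕ.+_) (spots n)) ≡⟨ cong (1 ∷_) (map-++ suc (spots i) _) ⟩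
  1 ∷ map suc (spots i) ++ map suc (map (i ℕ.+_) (spots n))
    ≡⟨ cong₂ _++_ (≡.sym (spots-suc i)) (≡.sym (map-∘ (spots n))) ⟩
  spots (suc i) ++ map (suc i ℕ.+_) (spots n) ∎
  where open ≡.≡-Reasoning

module Sums {c ℓ} (R : CommutativeRing c ℓ) where
  open CommutativeRing R
  open RingEval R
  open import Relation.Binary.Reasoning.Setoid setoid
  open import Algebra.Properties.CommutativeSemigroup +-commutativeSemigroup using (interchange)

  ∑ : ∀ {a} {A : Set a} → List A → (A → Carrier) → Carrier
  ∑ xs f = sumR (map f xs)

  module _ {a} {A : Set a} where

    ∑-congᴬ : ∀ {f g : A → Carrier} {xs} → All (λ x → f x ≈ g x) xs → ∑ xs f ≈ ∑ xs g
    ∑-congᴬ []       = refl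
    ∑-congᴬ (e ∷ es) = +-cong e (∑-congᴬ es)

    ∑-cong : ∀ {f g : A → Carrier} xs → (∀ x → f x ≈ g x) → ∑ xs f ≈ ∑ xs g
    ∑-cong xs e = ∑-congᴬ (All.universal e xs)

    ∑-++ : ∀ {f : A → Carrier} xs ys → ∑ (xs ++ ys) f ≈ ∑ xs f + ∑ ys f
    ∑-++ []       ys = sym (+-identityˡ _)
    ∑-++ (x ∷ xs) ys = trans (+-congˡ (∑-++ xs ys)) (sym (+-assoc _ _ _))

    ∑-0 : ∀ (xs : List A) → ∑ xs (λ _ → 0#) ≈ 0#
    ∑-0 []       = refl
    ∑-0 (x ∷ xs) = trans (+-identityˡ _) (∑-0 xs)

    ∑-+ : ∀ {f g : A → Carrier} xs → ∑ xs (λ x → f x + g x) ≈ ∑ xs f + ∑ xs g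
    ∑-+ []       = sym (+-identityˡ _)
    ∑-+ (x ∷ xs) = trans (+-congˡ (∑-+ xs)) (interchange _ _ _ _)

    ∑-*ˡ : ∀ {f : A → Carrier} d xs → ∑ xs (λ x → d * f x) ≈ d * ∑ xs f
    ∑-*ˡ d []       = sym (zeroʳ d)
    ∑-*ˡ d (x ∷ xs) = trans (+-congˡ (∑-*ˡ d xs)) (sym (distribˡ d _ _))

    ∑-*ʳ : ∀ {f : A → Carrier} d xs → ∑ xs (λ x → f x * d) ≈ ∑ xs f * d
    ∑-*ʳ d []       = sym (zeroˡ d)
    ∑-*ʳ d (x ∷ xs) = trans (+-congˡ (∑-*ʳ d xs)) (sym (distribʳ d _ _))

    ∑-filter : ∀ p {f : A → Carrier} xs → ∑ (filterᵇ p xs) f ≈ ∑ xs (λ x → if p x then f x else 0#)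
    ∑-filter p [] = refl
    ∑-filter p (x ∷ xs) with p x
    ... | true  = +-congˡ (∑-filter p xs)
    ... | false = trans (∑-filter p xs) (sym (+-identityˡ _))

  module _ {a b} {A : Set a} {B : Set b} where

    ∑-map : ∀ (f : B → Carrier) (h : A → B) xs → ∑ (map h xs) f ≈ ∑ xs (f ∘ h)
    ∑-map f h xs = reflexive (cong sumR (≡.sym (map-∘ xs)))

    ∑-concatMap : ∀ {f : B → Carrier} (h : A → List B) xs → ∑ (concatMap h xs) f ≈ ∑ xs (λ x → ∑ (h x) f)
    ∑-concatMap h []       = refl
    ∑-concatMap h (x ∷ xs) = trans (∑-++ (h x) _) (+-congˡ (∑-concatMap h xs))

    ∑-swap : ∀ {f : A → B → Carrier} xs ys → ∑ xs (λ x → ∑ ys (f x)) ≈ ∑ ys (λ y → ∑ xs (λ x → f x y))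
    ∑-swap []       ys = sym (∑-0 ys)
    ∑-swap (x ∷ xs) ys = trans (+-congˡ (∑-swap xs ys)) (sym (∑-+ ys))

    ∑-* : ∀ {f : A → Carrier} {g : B → Carrier} xs ys → ∑ xs (λ x → ∑ ys (λ y → f x * g y)) ≈ ∑ xs f * ∑ ys g
    ∑-* xs ys = trans (∑-cong xs (λ x → ∑-*ˡ _ ys)) (∑-*ʳ _ xs)

  ∑-upTo-suc : ∀ f n → ∑ (upTo (suc n)) f ≈ f 0 + ∑ (upTo n) (f ∘ suc)
  ∑-upTo-suc f n = trans (reflexive (cong (λ l → ∑ l f) (upTo-suc n))) (+-congˡ (∑-map f suc (upTo n)))

  ∑-upTo-pick : ∀ f {k n} → k < n → ∑ (upTo n) (λ i → if k ≡ᵇ i then f i else 0#) ≈ f k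
  ∑-upTo-pick f {zero} {suc n} _ = begin
    ∑ (upTo (suc n)) (λ i → if 0 ≡ᵇ i then f i else 0#) ≈⟨ ∑-upTo-suc _ n ⟩
    f 0 + ∑ (upTo n) (λ _ → 0#) ≈⟨ +-congˡ (∑-0 (upTo n)) ⟩
    f 0 + 0# ≈⟨ +-identityʳ _ ⟩
    f 0 ∎
  ∑-upTo-pick f {suc k} {suc n} (s≤s lt) = begin
    ∑ (upTo (suc n)) (λ i → if suc k ≡ᵇ i then f i else 0#) ≈⟨ ∑-upTo-suc _ n ⟩
    0# + ∑ (upTo n) (λ i → if k ≡ᵇ i then f (suc i) else 0#) ≈⟨ +-identityˡ _ ⟩
    ∑ (upTo n) (λ i → if k ≡ᵇ i then f (suc i) else 0#) ≈⟨ ∑-upTo-pick (f ∘ suc) lt ⟩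
    f (suc k) ∎

  -- binomial r g is the sum of C(r,k) g k (r − k) over 0 ≤ k ≤ r, organised by Pascal's rule.
  binomial : ℕ → (ℕ → ℕ → Carrier) → Carrier
  binomial zero    g = g 0 0
  binomial (suc r) g = binomial r (λ k j → g k (suc j)) + binomial r (λ k j → g (suc k) j)

  binomial-cong : ∀ {g h} r → (∀ k j → k ℕ.+ j ≡ r → g k j ≈ h k j) → binomial r g ≈ binomial r h
  binomial-cong zero    e = e 0 0 ≡.refl
  binomial-cong (suc r) e = +-cong
    (binomial-cong r (λ k j eq → e k (suc j) (≡.trans (ℕ.+-suc k j) (cong suc eq))))
    (binomial-cong r (λ k j eq → e (suc k) j (cong suc eq)))

  binomial-+ : ∀ {g h} r → binomial r (λ k j → g k j + h k j) ≈ binomial r g + binomial r h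
  binomial-+ zero    = refl
  binomial-+ (suc r) = trans (+-cong (binomial-+ r) (binomial-+ r)) (interchange _ _ _ _)

  binomial-0 : ∀ r → binomial r (λ _ _ → 0#) ≈ 0#
  binomial-0 zero    = refl
  binomial-0 (suc r) = trans (+-cong (binomial-0 r) (binomial-0 r)) (+-identityˡ 0#)

  binomial-∑ : ∀ {a} {A : Set a} {g : A → ℕ → ℕ → Carrier} xs r →
    ∑ xs (λ x → binomial r (g x)) ≈ binomial r (λ k j → ∑ xs (λ x → g x k j))
  binomial-∑ xs zero    = refl
  binomial-∑ xs (suc r) = trans (∑-+ xs) (+-cong (binomial-∑ xs r) (binomial-∑ xs r))

  binomial-first : ∀ {g} r → (∀ k j → g (suc k) j ≈ 0#) → binomial r g ≈ g 0 r
  binomial-first zero    z = refl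
  binomial-first (suc r) z = begin
    binomial r _ + binomial r _
      ≈⟨ +-cong (binomial-first r (λ k j → z k (suc j))) (binomial-cong r (λ k j _ → z k j)) ⟩
    _ + binomial r (λ _ _ → 0#) ≈⟨ +-congˡ (binomial-0 r) ⟩
    _ + 0# ≈⟨ +-identityʳ _ ⟩
    _ ∎

  binomial-last : ∀ {g} r → (∀ k j → g k (suc j) ≈ 0#) → binomial r g ≈ g r 0
  binomial-last zero    z = refl
  binomial-last (suc r) z = begin
    binomial r _ + binomial r _
      ≈⟨ +-cong (binomial-cong r (λ k j _ → z k j)) (binomial-last r (λ k j → z (suc k) j)) ⟩
    binomial r (λ _ _ → 0#) + _ ≈⟨ +-congʳ (binomial-0 r) ⟩
    0# + _ ≈⟨ +-identityˡ _ ⟩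
    _ ∎

  module _ {a} {A : Set a} where

    ∑-words-suc : ∀ {f : List A → Carrier} m Γ →
      ∑ (words (suc m) Γ) f ≈ ∑ Γ (λ p → ∑ (words m Γ) (λ w → f (p ∷ w)))
    ∑-words-suc {f} m Γ = trans (∑-concatMap _ Γ) (∑-cong Γ (λ p → ∑-map f (p ∷_) (words m Γ)))

    -- A word over `Γ ++ Δ` amounts to its two subwords and the set of positions of the first.
    -- Whether the first letter lies in `Γ` or in `Δ` is the case distinction of Pascal's rule.
    ∑-shuffle : ∀ {p : A → Bool} {Γ Δ} → All (λ q → p q ≡ true) Γ → All (λ q → p q ≡ false) Δ →
      ∀ m (F : List A → List A → Carrier) →
      ∑ (words m (Γ ++ Δ)) (λ w → F (filterᵇ p w) (filterᵇ (not ∘ p) w)) ≈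
      binomial m (λ k j → ∑ (words k Γ) (λ u → ∑ (words j Δ) (F u)))
    ∑-shuffle inΓ inΔ zero F = +-congʳ (sym (+-identityʳ _))
    ∑-shuffle {p} {Γ} {Δ} inΓ inΔ (suc m) F = begin
      ∑ (words (suc m) (Γ ++ Δ)) G ≈⟨ ∑-words-suc m (Γ ++ Δ) ⟩
      ∑ (Γ ++ Δ) (λ q → ∑ W (λ w → G (q ∷ w))) ≈⟨ ∑-++ Γ Δ ⟩
      ∑ Γ (λ q → ∑ W (λ w → G (q ∷ w))) + ∑ Δ (λ q → ∑ W (λ w → G (q ∷ w))) ≈⟨ +-comm _ _ ⟩
      ∑ Δ (λ q → ∑ W (λ w → G (q ∷ w))) + ∑ Γ (λ q → ∑ W (λ w → G (q ∷ w))) ≈⟨ +-cong sumΔ sumΓ ⟩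
      binomial (suc m) (λ k j → ∑ (words k Γ) (λ u → ∑ (words j Δ) (F u))) ∎
      where
      W = words m (Γ ++ Δ)
      G = λ w → F (filterᵇ p w) (filterᵇ (not ∘ p) w)
      stepΓ : ∀ {q} → p q ≡ true → ∑ W (λ w → G (q ∷ w)) ≈ ∑ W
        (λ w → F (q ∷ filterᵇ p w) (filterᵇ (not ∘ p) w))
      stepΓ eq rewrite eq = refl
      stepΔ : ∀ {q} → p q ≡ false → ∑ W (λ w → G (q ∷ w)) ≈ ∑ W
        (λ w → F (filterᵇ p w) (q ∷ filterᵇ (not ∘ p) w))
      stepΔ eq rewrite eq = refl
      sumΓ : ∑ Γ (λ q → ∑ W (λ w → G (q ∷ w))) ≈
        binomial m (λ k j → ∑ (words (suc k) Γ) (λ u → ∑ (words j Δ) (F u)))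
      sumΓ = begin
        ∑ Γ (λ q → ∑ W (λ w → G (q ∷ w)))
          ≈⟨ ∑-congᴬ (All.map (λ {q} eq → trans (stepΓ eq) (∑-shuffle inΓ inΔ m (λ u v → F (q ∷ u) v))) inΓ) ⟩
        ∑ Γ (λ q → binomial m (λ k j → ∑ (words k Γ) (λ u → ∑ (words j Δ) (F (q ∷ u))))) ≈⟨ binomial-∑ Γ m ⟩
        binomial m (λ k j → ∑ Γ (λ q → ∑ (words k Γ) (λ u → ∑ (words j Δ) (F (q ∷ u)))))
          ≈⟨ binomial-cong m (λ k j _ → sym (∑-words-suc k Γ)) ⟩
        binomial m (λ k j → ∑ (words (suc k) Γ) (λ u → ∑ (words j Δ) (F u))) ∎
      sumΔ : ∑ Δ (λ q → ∑ W (λ w → G (q ∷ w))) ≈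
        binomial m (λ k j → ∑ (words k Γ) (λ u → ∑ (words (suc j) Δ) (F u)))
      sumΔ = begin
        ∑ Δ (λ q → ∑ W (λ w → G (q ∷ w)))
          ≈⟨ ∑-congᴬ (All.map (λ {q} eq → trans (stepΔ eq) (∑-shuffle inΓ inΔ m (λ u v → F u (q ∷ v)))) inΔ) ⟩
        ∑ Δ (λ q → binomial m (λ k j → ∑ (words k Γ) (λ u → ∑ (words j Δ) (λ v → F u (q ∷ v)))))
          ≈⟨ binomial-∑ Δ m ⟩
        binomial m (λ k j → ∑ Δ (λ q → ∑ (words k Γ) (λ u → ∑ (words j Δ) (λ v → F u (q ∷ v)))))
          ≈⟨ binomial-cong m (λ k j _ → ∑-swap Δ (words k Γ)) ⟩
        binomial m (λ k j → ∑ (words k Γ) (λ u → ∑ Δ (λ q → ∑ (words j Δ) (λ v → F u (q ∷ v)))))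
          ≈⟨ binomial-cong m (λ k j _ → ∑-cong (words k Γ) (λ u → sym (∑-words-suc j Δ))) ⟩
        binomial m (λ k j → ∑ (words k Γ) (λ u → ∑ (words (suc j) Δ) (F u))) ∎

    ∑-words-map : ∀ {b} {B : Set b} {f : List A → Carrier} (h : B → A) m Γ →
      ∑ (words m (map h Γ)) f ≈ ∑ (words m Γ) (f ∘ map h)
    ∑-words-map h zero    Γ = refl
    ∑-words-map {f = f} h (suc m) Γ = begin
      ∑ (words (suc m) (map h Γ)) f ≈⟨ ∑-words-suc m (map h Γ) ⟩
      ∑ (map h Γ) (λ p → ∑ (words m (map h Γ)) (λ w → f (p ∷ w))) ≈⟨ ∑-map _ h Γ ⟩
      ∑ Γ (λ p → ∑ (words m (map h Γ)) (λ w → f (h p ∷ w))) ≈⟨ ∑-cong Γ (λ p → ∑-words-map h m Γ) ⟩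
      ∑ Γ (λ p → ∑ (words m Γ) (λ w → f (h p ∷ map h w)))
        ≈⟨ sym (trans (∑-concatMap _ Γ) (∑-cong Γ (λ p → ∑-map (f ∘ map h) (p ∷_) (words m Γ)))) ⟩
      ∑ (words (suc m) Γ) (f ∘ map h) ∎

  ∑-words-[1] : ∀ {f : ℕ → Carrier} k → ∑ (words k [ 1 ]) (f ∘ length) ≈ f k
  ∑-words-[1] zero    = +-identityʳ _
  ∑-words-[1] {f} (suc k) = trans (∑-words-suc k [ 1 ]) (trans (+-identityʳ _) (∑-words-[1] {f ∘ suc} k))

  ∑-lower-upper : ∀ i n m (F : List ℕ → List ℕ → Carrier) →
    ∑ (words m (spots (i ℕ.+ n))) (λ w → F (lower (suc i) w) (upper i w)) ≈
    binomial m (λ k j → ∑ (words k (spots i)) (λ u → ∑ (words j (spots n)) (F u)))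
  ∑-lower-upper i n m F = begin
    ∑ (words m (spots (i ℕ.+ n))) (λ w → F (lower (suc i) w) (upper i w))
      ≈⟨ reflexive (cong (λ Γ → ∑ (words m Γ) (λ w → F (lower (suc i) w) (upper i w))) (spots-+ i n)) ⟩
    ∑ (words m (spots i ++ map (i ℕ.+_) (spots n))) (λ w → F (lower (suc i) w) (upper i w))
      ≈⟨ ∑-cong (words m (spots i ++ _))
        (λ w → reflexive (cong (λ v → F (lower (suc i) w) (map (_∸ i) v))
          (filterᵇ-cong (λ q → ≡.sym (not-<ᵇ q)) w))) ⟩
    ∑ (words m (spots i ++ map (i ℕ.+_) (spots n)))
      (λ w → F′ (lower (suc i) w) (filterᵇ (λ q → not (q <ᵇ suc i)) w))
      ≈⟨ ∑-shuffle (All.map (λ (_ , le) → <⇒<ᵇ≡true (s≤s le)) (spots-range i))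
           (All.map⁺ (All.map (λ {q} (pos , _) →
             ≤⇒<ᵇ≡false (subst (_≤ i ℕ.+ q) (ℕ.+-comm i 1) (ℕ.+-monoʳ-≤ i pos))) (spots-range n))) m F′ ⟩
    binomial m (λ k j → ∑ (words k (spots i)) (λ u → ∑ (words j (map (i ℕ.+_) (spots n))) (F′ u)))
      ≈⟨ binomial-cong m (λ k j _ → ∑-cong (words k (spots i)) (λ u → trans (∑-words-map (i ℕ.+_) j (spots n))
           (∑-cong (words j (spots n)) (λ v → reflexive (cong (F u) (unshift v)))))) ⟩
    binomial m (λ k j → ∑ (words k (spots i)) (λ u → ∑ (words j (spots n)) (F u))) ∎
    where
    F′ = λ u v → F u (map (_∸ i) v)
    not-<ᵇ : ∀ q → not (q <ᵇ suc i) ≡ (i <ᵇ q)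
    not-<ᵇ q with q ℕ.≤? i
    ... | yes le rewrite <⇒<ᵇ≡true (s≤s le) = ≡.sym (≤⇒<ᵇ≡false le)
    ... | no gt rewrite ≤⇒<ᵇ≡false (ℕ.≰⇒> gt) = ≡.sym (<⇒<ᵇ≡true (ℕ.≰⇒> gt))
    unshift : ∀ v → map (_∸ i) (map (i ℕ.+_) v) ≡ v
    unshift v = ≡.trans (≡.sym (map-∘ v)) (≡.trans (map-cong (ℕ.m+n∸m≡n i) v) (map-id v))

-- The recurrences of the parking side

module Weights {c ℓ} (R : CommutativeRing c ℓ) (x y : CommutativeRing.Carrier R) where
  open CommutativeRing R
  open RingEval R
  open Sums R
  open import Relation.Binary.Reasoning.Setoid setoid
  open import Algebra.Properties.CommutativeSemigroup *-commutativeSemigroup using (x∙yz≈y∙xz; interchange)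

  z : Carrier
  z = x - 1#

  x≈1+z : x ≈ 1# + z
  x≈1+z = sym (trans (+-comm 1# z)
    (trans (+-assoc x (- 1#) 1#) (trans (+-congˡ (-‿inverseˡ 1#)) (+-identityʳ x))))

  pow-+ : ∀ a m n → pow a (m ℕ.+ n) ≈ pow a m * pow a n
  pow-+ a zero    n = sym (*-identityˡ _)
  pow-+ a (suc m) n = trans (*-congˡ (pow-+ a m n)) (sym (*-assoc a _ _))

  weight : ℕ → ℕ → List ℕ → Carrier
  weight a n w = if overflow n a w ≡ᵇ 0 then pow x (queueCm a w) * pow y (delay n a w) else 0#

  -- The case `classicalSum 0 n n` is the generating function of the classical parking functions of
  -- length `n`.
  classicalSum : ℕ → ℕ → ℕ → Carrier
  classicalSum a n r = ∑ (words r (spots n)) (weight a n)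

  -- The contribution of one spot to the weight: `e` critical maxima are found and `b` cars move on,
  -- each delayed by one.
  step-weight : ∀ a n b e w → overflow (suc n) a w ≡ overflow n b (upper 1 w) →
    queueCm a w ≡ e ℕ.+ queueCm b (upper 1 w) → delay (suc n) a w ≡ b ℕ.+ delay n b (upper 1 w) →
    weight a (suc n) w ≈ pow x e * (pow y b * weight b n (upper 1 w))
  step-weight a n b e w o q d rewrite o | q | d with overflow n b (upper 1 w)
  ... | zero  = begin
    pow x (e ℕ.+ queueCm b v) * pow y (b ℕ.+ delay n b v) ≈⟨ *-cong (pow-+ x e _) (pow-+ y b _) ⟩
    pow x e * pow x (queueCm b v) * (pow y b * pow y (delay n b v)) ≈⟨ *-assoc _ _ _ ⟩
    pow x e * (pow x (queueCm b v) * (pow y b * pow y (delay n b v))) ≈⟨ *-congˡ (x∙yz≈y∙xz _ _ _) ⟩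
    pow x e * (pow y b * (pow x (queueCm b v) * pow y (delay n b v))) ∎
    where v = upper 1 w
  ... | suc _ = sym (trans (*-congˡ (zeroʳ _)) (zeroʳ _))

  -- Here `k` of the `r` arriving cars prefer spot 1. One of the `a + 1 + k` cars there parks, and
  -- none of the arrivals is critical because of the waiting cars.
  classicalSum-suc : ∀ a n r → classicalSum (suc a) (suc n) r ≈
    binomial r (λ k j → pow y (a ℕ.+ k) * classicalSum (a ℕ.+ k) n j)
  classicalSum-suc a n r = begin
    classicalSum (suc a) (suc n) r
      ≈⟨ ∑-congᴬ (All.map (λ {w} pos →
        trans (step-weight (suc a) n (a ℕ.+ ones w) 0 w ≡.refl (queueCm-suc a w pos) ≡.refl) (*-identityˡ _))
          (words-positive r (suc n))) ⟩
    ∑ (words r (spots (suc n))) (λ w → F (lower 2 w) (upper 1 w)) ≈⟨ ∑-lower-upper 1 n r F ⟩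
    binomial r (λ k j → ∑ (words k [ 1 ]) (λ u → ∑ (words j (spots n)) (F u)))
      ≈⟨ binomial-cong r (λ k j _ → trans (∑-cong (words k [ 1 ]) (λ u → ∑-*ˡ _ (words j (spots n))))
           (∑-words-[1] {λ k → pow y (a ℕ.+ k) * classicalSum (a ℕ.+ k) n j} k)) ⟩
    binomial r (λ k j → pow y (a ℕ.+ k) * classicalSum (a ℕ.+ k) n j) ∎
    where
    F : List ℕ → List ℕ → Carrier
    F u v = pow y (a ℕ.+ length u) * weight (a ℕ.+ length u) n v

  -- The weight without the correction for a critical entry 1. With nobody at spot 1 it is 0: as
  -- there are as many cars as spots, leaving one empty forces an overflow.
  afterFirst : ℕ → ℕ → List ℕ → Carrier
  afterFirst zero    n v = 0#
  afterFirst (suc k) n v = pow y k * weight k n v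

  -- The factor x = 1 + (x − 1) occurs when the first car is the only one preferring spot 1.
  weight-zero : ∀ n q w → All (1 ≤_) (q ∷ w) → length w ≡ n →
    weight 0 (suc n) (q ∷ w) ≈ afterFirst (ones (q ∷ w)) n (upper 1 (q ∷ w))
      + (if q ≡ᵇ 1 then (if ones w ≡ᵇ 0 then z * weight 0 n (upper 1 w) else 0#) else 0#)
  weight-zero n zero w (() ∷ _)
  weight-zero n (suc zero) w pos len =
    trans (step-weight 0 n (ones w) _ (1 ∷ w) ≡.refl (queueCm-zero 1 w (ones w) pos ≡.refl) ≡.refl)
      (factor (ones w))
    where
    v = upper 1 w
    factor : ∀ o → pow x (if o ≡ᵇ 0 then 1 else 0) * (pow y o * weight o n v) ≈
                   pow y o * weight o n v + (if o ≡ᵇ 0 then z * weight 0 n v else 0#)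
    factor (suc o) = trans (*-identityˡ _) (sym (+-identityʳ _))
    factor zero = begin
      x * 1# * (1# * weight 0 n v) ≈⟨ *-cong (trans (*-identityʳ x) x≈1+z) (*-identityˡ _) ⟩
      (1# + z) * weight 0 n v ≈⟨ distribʳ _ _ _ ⟩
      1# * weight 0 n v + z * weight 0 n v ∎
  weight-zero n (suc (suc q)) w pos len = trans (by-ones (ones w) ≡.refl) (sym (+-identityʳ _))
    where
    v = upper 1 (suc (suc q) ∷ w)
    by-ones : ∀ k → ones w ≡ k → weight 0 (suc n) (suc (suc q) ∷ w) ≈ afterFirst k n v
    by-ones (suc b) eq = trans (step-weight 0 n b 0 (suc (suc q) ∷ w) (cong (λ o → overflow n (pred o) v) eq)
      (queueCm-zero (suc (suc q)) w b pos eq) (cong (λ o → pred o ℕ.+ delay n (pred o) v) eq)) (*-identityˡ _)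
    -- Nobody prefers spot 1, so `suc n` cars compete for the other `n` spots.
    by-ones zero eq = reflexive vanishes
      where
      full : length v ≡ suc n
      full = cong suc (≡.trans (cong (ℕ._+ length (upper 1 w)) (≡.sym eq))
        (≡.trans (length-lower-upper w) len))
      over : 1 ≤ overflow n 0 v
      over = ℕ.+-cancelˡ-≤ n 1 _ (ℕ.≤-trans (ℕ.≤-reflexive (≡.trans (ℕ.+-comm n 1) (≡.sym full)))
        (ℕ.≤-trans (ℕ.m≤n+m (length v) (length (empties n 0 v))) (ℕ.≤-reflexive (length-empties n 0 v))))
      vanishes : weight 0 (suc n) (suc (suc q) ∷ w) ≡ 0#
      vanishes rewrite eq with overflow n 0 v | over
      ... | suc _ | _ = ≡.refl

  -- Shifting down by one is a bijection from the words without the letter 1.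
  ∑-avoid-1 : ∀ n r f → ∑ (words r (spots (suc n))) (λ w → if ones w ≡ᵇ 0 then f (upper 1 w) else 0#) ≈
    ∑ (words r (spots n)) f
  ∑-avoid-1 n r f = begin
    ∑ (words r (spots (suc n))) (λ w → F (lower 2 w) (upper 1 w)) ≈⟨ ∑-lower-upper 1 n r F ⟩
    binomial r (λ k j → ∑ (words k [ 1 ]) (λ u → ∑ (words j (spots n)) (F u)))
      ≈⟨ binomial-cong r (λ k j _ → ∑-words-[1]
        {λ k → ∑ (words j (spots n)) (λ v → if k ≡ᵇ 0 then f v else 0#)} k) ⟩
    binomial r (λ k j → ∑ (words j (spots n)) (λ v → if k ≡ᵇ 0 then f v else 0#))
      ≈⟨ binomial-first r (λ k j → ∑-0 (words j (spots n))) ⟩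
    ∑ (words r (spots n)) f ∎
    where
    F : List ℕ → List ℕ → Carrier
    F u v = if length u ≡ᵇ 0 then f v else 0#

  -- The binomial sum takes every critical entry 1 with weight 1 instead of `x`. The missing `x` - 1
  -- belongs to the words `1 ∷ w` with no 1 in `w`, and these `w` are arbitrary words over the
  -- remaining spots.
  classicalSum-zero : ∀ n → classicalSum 0 (suc n) (suc n) ≈
    binomial (suc n) (λ k j → ∑ (words j (spots n)) (afterFirst k n)) + z * classicalSum 0 n n
  classicalSum-zero n = begin
    classicalSum 0 (suc n) (suc n) ≈⟨ ∑-words-suc n S ⟩
    ∑ S (λ q → ∑ W (λ w → weight 0 (suc n) (q ∷ w)))
      ≈⟨ ∑-congᴬ (All.map (λ {q} (pos , _) →
        ∑-congᴬ (All.zipWith (λ (wpos , len) → weight-zero n q _ (pos ∷ wpos) len)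
           (words-positive n (suc n) , words-length S n))) (spots-range (suc n))) ⟩
    ∑ S (λ q → ∑ W (λ w → F (lower 2 (q ∷ w)) (upper 1 (q ∷ w)) + E q w))
      ≈⟨ trans (∑-cong S (λ q → ∑-+ W)) (∑-+ S) ⟩
    ∑ S (λ q → ∑ W (λ w → F (lower 2 (q ∷ w)) (upper 1 (q ∷ w)))) + ∑ S (λ q → ∑ W (E q))
      ≈⟨ +-cong main extra ⟩
    binomial (suc n) (λ k j → ∑ (words j (spots n)) (afterFirst k n)) + z * classicalSum 0 n n ∎
    where
    S = spots (suc n)
    W = words n S
    F : List ℕ → List ℕ → Carrier
    F u v = afterFirst (length u) n v
    E : ℕ → List ℕ → Carrier
    E q w = if q ≡ᵇ 1 then (if ones w ≡ᵇ 0 then z * weight 0 n (upper 1 w) else 0#) else 0#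
    main : ∑ S (λ q → ∑ W (λ w → F (lower 2 (q ∷ w)) (upper 1 (q ∷ w)))) ≈
      binomial (suc n) (λ k j → ∑ (words j (spots n)) (afterFirst k n))
    main = begin
      ∑ S (λ q → ∑ W (λ w → F (lower 2 (q ∷ w)) (upper 1 (q ∷ w)))) ≈⟨ sym (∑-words-suc n S) ⟩
      ∑ (words (suc n) S) (λ w → F (lower 2 w) (upper 1 w)) ≈⟨ ∑-lower-upper 1 n (suc n) F ⟩
      binomial (suc n) (λ k j → ∑ (words k [ 1 ]) (λ u → ∑ (words j (spots n)) (F u)))
        ≈⟨ binomial-cong (suc n) (λ k j _ → ∑-words-[1] {λ k → ∑ (words j (spots n)) (afterFirst k n)} k) ⟩
      binomial (suc n) (λ k j → ∑ (words j (spots n)) (afterFirst k n)) ∎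
    extra : ∑ S (λ q → ∑ W (E q)) ≈ z * classicalSum 0 n n
    extra = begin
      ∑ S (λ q → ∑ W (E q)) ≈⟨ reflexive (cong (λ l → ∑ l (λ q → ∑ W (E q))) (spots-suc n)) ⟩
      ∑ W (E 1) + ∑ (map suc (spots n)) (λ q → ∑ W (E q)) ≈⟨ +-congˡ (∑-map (λ q → ∑ W (E q)) suc (spots n)) ⟩
      ∑ W (E 1) + ∑ (spots n) (λ q → ∑ W (E (suc q)))
        ≈⟨ +-congˡ (trans (∑-congᴬ (All.map (λ { (s≤s _ , _) → ∑-0 W }) (spots-range n))) (∑-0 (spots n))) ⟩
      ∑ W (E 1) + 0# ≈⟨ +-identityʳ _ ⟩
      ∑ W (E 1) ≈⟨ ∑-avoid-1 n n (λ v → z * weight 0 n v) ⟩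
      ∑ (words n (spots n)) (λ v → z * weight 0 n v) ≈⟨ ∑-*ˡ z (words n (spots n)) ⟩
      z * classicalSum 0 n n ∎

  -- The common value of both sides: the sum over the edge sets of a graph on r isolated vertices and
  -- a vertices already connected to each other (see explore).
  exploration : ℕ → ℕ → Carrier
  exploration zero    zero    = 1#
  exploration zero    (suc r) = z * classicalSum 0 r r
  exploration (suc a) r       = pow y a * classicalSum a (a ℕ.+ r) r

  classicalSum-0 : classicalSum 0 0 0 ≈ 1#
  classicalSum-0 = trans (+-identityʳ _) (*-identityˡ 1#)

  exploration-suc : ∀ a r → exploration (suc a) r ≈ pow y a * binomial r (λ k j → exploration (a ℕ.+ k) j)
  exploration-suc zero zero = *-congˡ classicalSum-0
  exploration-suc zero (suc n) = *-congˡ (begin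
    classicalSum 0 (suc n) (suc n) ≈⟨ classicalSum-zero n ⟩
    binomial (suc n) later + z * classicalSum 0 n n
      -- The correction is a binomial sum supported at `k` = 0, just where `later` vanishes; there
      -- it is `exploration 0 (suc n)`.
      ≈⟨ +-congˡ (sym (binomial-first {isolated} (suc n) (λ _ _ → refl))) ⟩
    binomial (suc n) later + binomial (suc n) isolated ≈⟨ sym (binomial-+ {later} {isolated} (suc n)) ⟩
    binomial (suc n) (λ k j → later k j + isolated k j) ≈⟨ binomial-cong (suc n) sum≈ ⟩
    binomial (suc n) (λ k j → exploration k j) ∎)
    where
    later isolated : ℕ → ℕ → Carrier
    later k j = ∑ (words j (spots n)) (afterFirst k n)
    isolated zero    j = z * classicalSum 0 n n
    isolated (suc _) _ = 0#
    sum≈ : ∀ k j → k ℕ.+ j ≡ suc n → later k j + isolated k j ≈ exploration k j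
    sum≈ zero    .(suc n) ≡.refl = trans (+-congʳ (∑-0 (words (suc n) (spots n)))) (+-identityˡ _)
    sum≈ (suc k) j ≡.refl = trans (+-identityʳ _) (∑-*ˡ _ (words j (spots n)))
  exploration-suc (suc a) r = *-congˡ (trans (classicalSum-suc a (a ℕ.+ r) r)
    (binomial-cong r λ { k j ≡.refl →
      *-congˡ (reflexive (cong (λ n → classicalSum (a ℕ.+ k) n j) (≡.sym (ℕ.+-assoc a k j)))) }))

  -- Parking functions split at their first empty spot.

  blockWeight : ℕ → List ℕ → Carrier
  blockWeight n w =
    if overflow n 0 w ≡ᵇ 0 then pow x (blockCm n (empties n 0 w) w) * pow y (delay n 0 w) else 0#

  parkingSum : ℕ → ℕ → Carrier
  parkingSum n m = ∑ (words m (spots n)) (blockWeight n)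

  lower-all : ∀ {n w} → All (λ q → 1 ≤ q × q ≤ n) w → lower (suc n) w ≡ w
  lower-all range = filterᵇ-true (All.map (λ (_ , le) → <⇒<ᵇ≡true (s≤s le)) range)

  parkingSum-classical : ∀ n → parkingSum n n ≈ classicalSum 0 n n
  parkingSum-classical n = ∑-congᴬ (All.zipWith (λ (range , len) → reflexive (same _ range len))
    (words-range n n , words-length (spots n) n))
    where
    same : ∀ w → All (λ q → 1 ≤ q × q ≤ n) w → length w ≡ n → blockWeight n w ≡ weight 0 n w
    same w range len with overflow n 0 w in over
    ... | suc _ = ≡.refl
    ... | zero with empties n 0 w | length-empties n 0 w
    -- If `n` cars do not overflow `n` spots, no spot is empty; the only block is then the whole
    -- word.
    ...   | _ ∷ es | count = ⊥-elim (ℕ.1+n≰n {n} (ℕ.≤-trans (ℕ.≤-reflexive (cong suc (≡.sym len)))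
              (ℕ.≤-trans (s≤s (ℕ.m≤n+m _ (length es)))
                (ℕ.≤-reflexive (≡.trans count (≡.trans (cong (n ℕ.+_) over) (ℕ.+-identityʳ n)))))))
    ...   | [] | _ = cong (λ e → pow x e * pow y (delay n 0 w)) (≡.trans (ℕ.+-identityʳ _)
              (≡.trans (cong cmClassical (≡.trans (block-lower (suc n) (All.map proj₁ range))
                (lower-all range))) (cmClassical-queueCm w)))

  -- Exactly one term survives: a word shorter than the number of spots leaves a first empty spot.
  ∑-fills : ∀ f {d} n a w → a ℕ.+ length w < n → (∀ i → i < n → fills i a w ≡ true → f i ≈ d) →
    ∑ (upTo n) (λ i → if fills i a w then f i else 0#) ≈ d
  ∑-fills f {d} (suc n) a w short eq = trans (∑-upTo-suc _ n) (by-queue (a ℕ.+ ones w) ≡.refl)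
    where
    by-queue : ∀ k → a ℕ.+ ones w ≡ k → (if a ℕ.+ ones w ≡ᵇ 0 then f 0 else 0#) +
      ∑ (upTo n) (λ i → if not (a ℕ.+ ones w ≡ᵇ 0) ∧ fills i (pred (a ℕ.+ ones w)) (upper 1 w) then f (suc i)
        else 0#) ≈ d
    by-queue zero e rewrite e = begin
      f 0 + ∑ (upTo n) (λ _ → 0#) ≈⟨ +-congˡ (∑-0 (upTo n)) ⟩
      f 0 + 0# ≈⟨ +-identityʳ _ ⟩
      f 0 ≈⟨ eq 0 (s≤s z≤n) (cong (_≡ᵇ 0) e) ⟩
      d ∎
    by-queue (suc b) e rewrite e = trans (+-identityˡ _) (∑-fills (f ∘ suc) n b (upper 1 w)
      (ℕ.≤-pred (subst (ℕ._< suc n) (length-split a w e) short))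
      (λ i lt fi → eq (suc i) (s≤s lt)
        (≡.trans (cong (λ k → not (k ≡ᵇ 0) ∧ fills i (pred k) (upper 1 w)) e) fi)))

  -- By `fills-spec` the summand is a product of a function of the preferences up to `i` and one of
  -- the later preferences. The first is supported on words of length `i`, the second on words
  -- avoiding spot `suc i`.
  firstEmpty : ∀ m i n → ∑ (words m (spots (i ℕ.+ suc n)))
    (λ w → if fills i 0 w then blockWeight (i ℕ.+ suc n) w else 0#) ≈
    binomial m (λ k j → (if k ≡ᵇ i then classicalSum 0 i k * parkingSum n j else 0#))
  firstEmpty m i n = begin
    ∑ W (λ w → if fills i 0 w then blockWeight (i ℕ.+ suc n) w else 0#)
      ≈⟨ ∑-congᴬ (All.map (factor _) (words-positive m (i ℕ.+ suc n))) ⟩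
    ∑ W (λ w → left (lower (suc i) w) * right (upper i w))
      ≈⟨ ∑-lower-upper i (suc n) m (λ u v → left u * right v) ⟩
    binomial m (λ k j → ∑ (words k (spots i)) (λ u → ∑ (words j (spots (suc n))) (λ v → left u * right v)))
      ≈⟨ binomial-cong m (λ k j _ → trans (∑-* (words k (spots i)) (words j (spots (suc n))))
           (trans (*-cong (leftSum k) (∑-avoid-1 n j (blockWeight n))) (select (k ≡ᵇ i)))) ⟩
    binomial m (λ k j → (if k ≡ᵇ i then classicalSum 0 i k * parkingSum n j else 0#)) ∎
    where
    W = words m (spots (i ℕ.+ suc n))
    left right : List ℕ → Carrier
    left u = if length u ≡ᵇ i then weight 0 i u else 0#
    right v = if ones v ≡ᵇ 0 then blockWeight n (upper 1 v) else 0#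
    select : ∀ b {p q} → (if b then p else 0#) * q ≈ (if b then p * q else 0#)
    select true  = refl
    select false = zeroˡ _
    leftSum : ∀ k → ∑ (words k (spots i)) left ≈ (if k ≡ᵇ i then classicalSum 0 i k else 0#)
    leftSum k = trans (∑-congᴬ (All.map
      (λ {u} len → reflexive (cong (λ l → if l ≡ᵇ i then weight 0 i u else 0#) len))
        (words-length (spots i) k)))
      (if-∑ (k ≡ᵇ i))
      where
      if-∑ : ∀ b → ∑ (words k (spots i)) (λ u → if b then weight 0 i u else 0#) ≈
        (if b then classicalSum 0 i k else 0#)
      if-∑ true  = refl
      if-∑ false = ∑-0 (words k (spots i))
    split : ∀ w → All (1 ≤_) w → fills i 0 w ≡ true → overflow i 0 (lower (suc i) w) ≡ 0 →
      blockWeight (i ℕ.+ suc n) w ≈ weight 0 i (lower (suc i) w) * blockWeight n (upper (suc i) w)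
    split w pos f o rewrite o | overflow-split i n 0 w f | empties-split i n 0 w f | delay-split i n 0 w f
      | blockCm-split i n (empties n 0 (upper (suc i) w)) w pos | cmClassical-queueCm (lower (suc i) w)
      with overflow n 0 (upper (suc i) w)
    ... | zero  = trans (*-cong
        (pow-+ x (queueCm 0 (lower (suc i) w)) (blockCm n (empties n 0 (upper (suc i) w)) (upper (suc i) w)))
        (pow-+ y (delay i 0 (lower (suc i) w)) (delay n 0 (upper (suc i) w)))) (interchange _ _ _ _)
    ... | suc _ = sym (zeroʳ _)
    factor : ∀ w → All (1 ≤_) w → (if fills i 0 w then blockWeight (i ℕ.+ suc n) w else 0#) ≈ left
      (lower (suc i) w) * right (upper i w)
    factor w pos with fills i 0 w in f | fills-spec i 0 w pos
    -- One of the three conditions fails, and each is tested by `left` or `right`, so the product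
    -- vanishes too.
    ... | false | spec = sym (absorb (overflow i 0 (lower (suc i) w) ≡ᵇ 0) _ _ (≡.sym spec))
      where
      absorb : ∀ a l o {g h} → (a ∧ l) ∧ o ≡ false →
        (if l then (if a then g else 0#) else 0#) * (if o then h else 0#) ≈ 0#
      absorb true  true  false _ = zeroʳ _
      absorb true  false _     _ = zeroˡ _
      absorb false true  _     _ = zeroˡ _
      absorb false false _     _ = zeroˡ _
    ... | true | spec with overflow i 0 (lower (suc i) w) in o | length (lower (suc i) w) ≡ᵇ i | ones
      (upper i w) ≡ᵇ 0
    ...   | zero | true | true = begin
      blockWeight (i ℕ.+ suc n) w ≈⟨ split w pos f o ⟩
      weight 0 i (lower (suc i) w) * blockWeight n (upper (suc i) w)
        ≈⟨ *-congˡ (reflexive (cong (blockWeight n) (upper-upper′ i pos))) ⟩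
      weight 0 i (lower (suc i) w) * blockWeight n (upper 1 (upper i w))
        ≈⟨ *-congʳ (reflexive (cong (λ o → if o ≡ᵇ 0 then g else 0#) o)) ⟩
      g * blockWeight n (upper 1 (upper i w)) ∎
      where g = pow x (queueCm 0 (lower (suc i) w)) * pow y (delay i 0 (lower (suc i) w))

  -- There are fewer cars than spots, so a first empty spot `i + 1` exists; summing over it, exactly
  -- `k = i` cars prefer a spot before it.
  parkingSum-split : ∀ m s → parkingSum (m ℕ.+ suc s) m ≈
    binomial m (λ k j → classicalSum 0 k k * parkingSum (j ℕ.+ s) j)
  parkingSum-split m s = begin
    ∑ W (blockWeight N)
      ≈⟨ ∑-congᴬ (All.map (λ len → sym
        (∑-fills (λ _ → blockWeight N _) N 0 _ (subst (_< N) (≡.sym len) m<N) (λ _ _ _ → refl)))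
          (words-length (spots N) m)) ⟩
    ∑ W (λ w → ∑ (upTo N) (λ i → if fills i 0 w then blockWeight N w else 0#)) ≈⟨ ∑-swap W (upTo N) ⟩
    ∑ (upTo N) (λ i → ∑ W (λ w → if fills i 0 w then blockWeight N w else 0#))
      ≈⟨ ∑-congᴬ (All.map (λ {i} lt → at i lt) (upTo-< N)) ⟩
    ∑ (upTo N) (λ i → binomial m (λ k j → if k ≡ᵇ i then classicalSum 0 i k * parkingSum (N ∸ suc i) j else
      0#))
      ≈⟨ binomial-∑ (upTo N) m ⟩
    binomial m (λ k j → ∑ (upTo N) (λ i → if k ≡ᵇ i then classicalSum 0 i k * parkingSum (N ∸ suc i) j else
      0#))
      ≈⟨ binomial-cong m (λ k j e → trans
        (∑-upTo-pick (λ i → classicalSum 0 i k * parkingSum (N ∸ suc i) j)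
          (ℕ.≤-<-trans (subst (k ≤_) e (ℕ.m≤m+n k j)) m<N))
           (*-congˡ (reflexive (cong (λ n → parkingSum n j) (remaining k j e))))) ⟩
    binomial m (λ k j → classicalSum 0 k k * parkingSum (j ℕ.+ s) j) ∎
    where
    N = m ℕ.+ suc s
    W = words m (spots N)
    m<N : m < N
    m<N = subst (m <_) (≡.sym (ℕ.+-suc m s)) (s≤s (ℕ.m≤m+n m s))
    remaining : ∀ k j → k ℕ.+ j ≡ m → N ∸ suc k ≡ j ℕ.+ s
    remaining k j ≡.refl = ≡.trans (cong (_∸ suc k)
      (≡.trans (ℕ.+-suc (k ℕ.+ j) s) (cong suc (ℕ.+-assoc k j s)))) (ℕ.m+n∸m≡n k (j ℕ.+ s))
    at : ∀ i → i < N → ∑ W (λ w → if fills i 0 w then blockWeight N w else 0#) ≈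
      binomial m (λ k j → if k ≡ᵇ i then classicalSum 0 i k * parkingSum (N ∸ suc i) j else 0#)
    at i lt = subst (λ n → ∑ (words m (spots n)) (λ w → if fills i 0 w then blockWeight n w else 0#) ≈
      binomial m (λ k j → if k ≡ᵇ i then classicalSum 0 i k * parkingSum (N ∸ suc i) j else 0#))
      (≡.trans (ℕ.+-suc i _) (ℕ.m+[n∸m]≡n lt)) (firstEmpty m i (N ∸ suc i))

-- The Tutte polynomial by deletion and contraction

module Kernels {v} {V : Set v} where

  identify : ℕ → ℕ → ℕ → ℕ
  identify α β i = if i ≡ᵇ β then α else i

  merge : (V → ℕ) → V × V → V → ℕ
  merge L (u , v) w = identify (L u) (L v) (L w)

  infix 4 _⊑_ _∼_

  -- Inclusion and equality of kernels: a labelling matters only through the partition of the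
  -- vertices that it defines.
  _⊑_ _∼_ : (V → ℕ) → (V → ℕ) → Set v
  L ⊑ M = ∀ {a b} → L a ≡ L b → M a ≡ M b
  L ∼ M = (L ⊑ M) × (M ⊑ L)

  ⊑-merge : ∀ L e → L ⊑ merge L e
  ⊑-merge L (u , v) = cong (identify (L u) (L v))

  merge-hit : ∀ L {u v w} → L w ≡ L v → merge L (u , v) w ≡ L u
  merge-hit L {v = v} eq rewrite eq | ≡ᵇ-refl (L v) = ≡.refl

  merge-miss : ∀ L {u v w} → L w ≢ L v → merge L (u , v) w ≡ L w
  merge-miss L ne rewrite ≢⇒≡ᵇ≡false ne = ≡.refl

  merge-source : ∀ L u v → merge L (u , v) u ≡ L u
  merge-source L u v with L u ℕ.≟ L v
  ... | yes eq = merge-hit L eq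
  ... | no ne  = merge-miss L ne

  merge-joins : ∀ L u v → merge L (u , v) u ≡ merge L (u , v) v
  merge-joins L u v = ≡.trans (merge-source L u v) (≡.sym (merge-hit L ≡.refl))

  -- merge L (u , v) is the coequaliser of u and v over L; the exchange lemmas follow from this universal property.
  merge-least : ∀ L M u v → L ⊑ M → M u ≡ M v → merge L (u , v) ⊑ M
  merge-least L M u v le uv {a} {b} eq with L a ℕ.≟ L v | L b ℕ.≟ L v
  ... | yes p | yes q = le (≡.trans p (≡.sym q))
  ... | yes p | no q  = ≡.trans (le p) (≡.trans (≡.sym uv)
          (le (≡.trans (≡.sym (merge-hit L p)) (≡.trans eq (merge-miss L q)))))
  ... | no p  | yes q = ≡.trans (le (≡.trans (≡.sym (merge-miss L p)) (≡.trans eq (merge-hit L q))))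
          (≡.trans uv (≡.sym (le q)))
  ... | no p  | no q  = le (≡.trans (≡.sym (merge-miss L p)) (≡.trans eq (merge-miss L q)))

  merge-mono : ∀ L M e → L ⊑ M → merge L e ⊑ merge M e
  merge-mono L M (u , v) le = merge-least L (merge M (u , v)) u v (⊑-merge M (u , v) ∘ le) (merge-joins M u v)

  merge-∼ : ∀ L M e → L ∼ M → merge L e ∼ merge M e
  merge-∼ L M e (le , ge) = merge-mono L M e le , merge-mono M L e ge

  merge-flip : ∀ L u v → merge L (u , v) ⊑ merge L (v , u)
  merge-flip L u v = merge-least L (merge L (v , u)) u v (⊑-merge L (v , u)) (≡.sym (merge-joins L v u))

  merge-exchange : ∀ L e f → merge (merge L e) f ⊑ merge (merge L f) e
  merge-exchange L (u , v) (u′ , v′) = merge-least (merge L (u , v)) M u′ v′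
    (merge-least L M u v (⊑-merge M₁ (u , v) ∘ ⊑-merge L (u′ , v′)) (merge-joins M₁ u v))
    (⊑-merge M₁ (u , v) (merge-joins L u′ v′))
    where
    M₁ M : V → ℕ
    M₁ = merge L (u′ , v′)
    M = merge M₁ (u , v)

  -- If contracting one edge turns another into a loop, the two join the same pair of classes, which
  -- is a symmetric relation.
  parallel : ∀ L u v {u′ v′} → L u′ ≢ L v′ → merge L (u , v) u′ ≡ merge L (u , v) v′ →
    merge L (u′ , v′) u ≡ merge L (u′ , v′) v
  parallel L u v {u′} {v′} ne eq with L u′ ℕ.≟ L v | L v′ ℕ.≟ L v
  ... | yes p | yes q = ⊥-elim (ne (≡.trans p (≡.sym q)))
  ... | no p  | no q  = ⊥-elim (ne (≡.trans (≡.sym (merge-miss L p)) (≡.trans eq (merge-miss L q))))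
  ... | yes p | no q  = ≡.trans (⊑-merge L (u′ , v′)
    (≡.trans (≡.sym (merge-hit L p)) (≡.trans eq (merge-miss L q))))
          (≡.trans (≡.sym (merge-joins L u′ v′)) (⊑-merge L (u′ , v′) p))
  ... | no p  | yes q = ≡.trans (⊑-merge L (u′ , v′)
    (≡.sym (≡.trans (≡.sym (merge-miss L p)) (≡.trans eq (merge-hit L q)))))
          (≡.trans (merge-joins L u′ v′) (⊑-merge L (u′ , v′) q))

pairs : ∀ {a} {A : Set a} → List A → List (A × A)
pairs []       = []
pairs (v ∷ vs) = map (v ,_) vs ++ pairs vs

-- Independence of the order and orientation of the edges.

module Graphs {c ℓ} (R : CommutativeRing c ℓ) (x y : CommutativeRing.Carrier R) {v} {V : Set v} where
  open CommutativeRing R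
  open RingEval R
  open Sums R
  open Weights R x y
  open Kernels {V = V}
  open import Relation.Binary.Reasoning.Setoid setoid
  open import Algebra.Properties.CommutativeSemigroup +-commutativeSemigroup using () renaming
    (x∙yz≈y∙xz to +-exchange)

  -- L labels the contracted classes, and c is their number minus one.
  tutte : (V → ℕ) → ℕ → List (V × V) → Carrier
  tutte L c []             = pow z c
  tutte L c ((u , v) ∷ es) =
    -- Bridges follow the same rule as other links: deleting one leaves an additional component,
    -- paid for by a factor `z` at the end, and `1 + z` is `x`.
    if L u ≡ᵇ L v then y * tutte L c es else tutte L c es + tutte (merge L (u , v)) (pred c) es

  tutte-loop : ∀ L c u v es → L u ≡ L v → tutte L c ((u , v) ∷ es) ≡ y * tutte L c es
  tutte-loop L c u v es eq rewrite eq | ≡ᵇ-refl (L v) = ≡.refl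

  tutte-link : ∀ L c u v es → L u ≢ L v →
    tutte L c ((u , v) ∷ es) ≡ tutte L c es + tutte (merge L (u , v)) (pred c) es
  tutte-link L c u v es ne rewrite ≢⇒≡ᵇ≡false ne = ≡.refl

  tutte-∼ : ∀ L M c es → L ∼ M → tutte L c es ≈ tutte M c es
  tutte-∼ L M c [] _ = refl
  tutte-∼ L M c ((u , v) ∷ es) (le , ge) with L u ℕ.≟ L v
  ... | yes eq = begin
    tutte L c ((u , v) ∷ es) ≡⟨ tutte-loop L c u v es eq ⟩
    y * tutte L c es ≈⟨ *-congˡ (tutte-∼ L M c es (le , ge)) ⟩
    y * tutte M c es ≡⟨ tutte-loop M c u v es (le eq) ⟨
    tutte M c ((u , v) ∷ es) ∎
  ... | no ne = begin
    tutte L c ((u , v) ∷ es) ≡⟨ tutte-link L c u v es ne ⟩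
    tutte L c es + tutte (merge L (u , v)) (pred c) es
      ≈⟨ +-cong (tutte-∼ L M c es (le , ge))
        (tutte-∼ (merge L (u , v)) (merge M (u , v)) (pred c) es (merge-∼ L M (u , v) (le , ge))) ⟩
    tutte M c es + tutte (merge M (u , v)) (pred c) es ≡⟨ tutte-link M c u v es (ne ∘ ge) ⟨
    tutte M c ((u , v) ∷ es) ∎

  infix 4 _≅_
  -- Quantified over all labellings and counts, since reading a common prefix of edges changes both.
  _≅_ : List (V × V) → List (V × V) → Set _
  es ≅ fs = ∀ L c → tutte L c es ≈ tutte L c fs

  ≅-prefix : ∀ ds {es fs} → es ≅ fs → ds ++ es ≅ ds ++ fs
  ≅-prefix [] eq = eq
  ≅-prefix ((u , v) ∷ ds) {es} {fs} eq L c with L u ≡ᵇ L v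
  ... | true  = *-congˡ (≅-prefix ds {es} {fs} eq L c)
  ... | false = +-cong (≅-prefix ds {es} {fs} eq L c) (≅-prefix ds {es} {fs} eq _ _)

  ≅-flip : ∀ u v es → (u , v) ∷ es ≅ (v , u) ∷ es
  ≅-flip u v es L c with L u ℕ.≟ L v
  ... | yes eq = reflexive (≡.trans (tutte-loop L c u v es eq) (≡.sym (tutte-loop L c v u es (≡.sym eq))))
  ... | no ne  = begin
    tutte L c ((u , v) ∷ es) ≡⟨ tutte-link L c u v es ne ⟩
    tutte L c es + tutte (merge L (u , v)) (pred c) es
      ≈⟨ +-congˡ (tutte-∼ (merge L (u , v)) (merge L (v , u)) (pred c) es
        (merge-flip L u v , merge-flip L v u)) ⟩
    tutte L c es + tutte (merge L (v , u)) (pred c) es ≡⟨ tutte-link L c v u es (ne ∘ ≡.sym) ⟨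
    tutte L c ((v , u) ∷ es) ∎

  -- A loop remains a loop after any contraction, so its factor `y` comes out in either order.
  exchange-loop : ∀ L c e u v es → L u ≡ L v → tutte L c (e ∷ (u , v) ∷ es) ≈ tutte L c ((u , v) ∷ e ∷ es)
  exchange-loop L c (p , q) u v es loop with L p ℕ.≟ L q
  ... | yes eq = begin
    tutte L c ((p , q) ∷ (u , v) ∷ es)
      ≡⟨ ≡.trans (tutte-loop L c p q ((u , v) ∷ es) eq) (cong (y *_) (tutte-loop L c u v es loop)) ⟩
    y * (y * tutte L c es)
      ≡⟨ ≡.trans (tutte-loop L c u v ((p , q) ∷ es) loop) (cong (y *_) (tutte-loop L c p q es eq)) ⟨
    tutte L c ((u , v) ∷ (p , q) ∷ es) ∎
  ... | no ne = begin
    tutte L c ((p , q) ∷ (u , v) ∷ es)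
      ≡⟨ ≡.trans (tutte-link L c p q ((u , v) ∷ es) ne)
        (cong₂ _+_ (tutte-loop L c u v es loop)
          (tutte-loop (merge L (p , q)) (pred c) u v es (⊑-merge L (p , q) loop))) ⟩
    y * tutte L c es + y * tutte (merge L (p , q)) (pred c) es ≈⟨ distribˡ y _ _ ⟨
    y * (tutte L c es + tutte (merge L (p , q)) (pred c) es)
      ≡⟨ ≡.trans (tutte-loop L c u v ((p , q) ∷ es) loop) (cong (y *_) (tutte-link L c p q es ne)) ⟨
    tutte L c ((u , v) ∷ (p , q) ∷ es) ∎

  -- For two links, the branches where at most one edge is contracted first match crosswise. If
  -- contracting one makes the other a loop, the edges are parallel and both contractions give the
  -- same partition; otherwise `merge-exchange` identifies the double contractions.
  ≅-exchange : ∀ e f es → e ∷ f ∷ es ≅ f ∷ e ∷ es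
  ≅-exchange (p , q) (u , v) es L c with L p ℕ.≟ L q | L u ℕ.≟ L v
  ... | _      | yes eq = exchange-loop L c (p , q) u v es eq
  ... | yes eq | no _   = sym (exchange-loop L c (u , v) p q es eq)
  ... | no e≢  | no f≢  = begin
    tutte L c ((p , q) ∷ (u , v) ∷ es)
      ≡⟨ ≡.trans (tutte-link L c p q ((u , v) ∷ es) e≢)
        (cong (_+ tutte Lₑ (pred c) ((u , v) ∷ es)) (tutte-link L c u v es f≢)) ⟩
    tutte L c es + tutte L_f (pred c) es + tutte Lₑ (pred c) ((u , v) ∷ es) ≈⟨ +-assoc _ _ _ ⟩
    tutte L c es + (tutte L_f (pred c) es + tutte Lₑ (pred c) ((u , v) ∷ es)) ≈⟨ +-congˡ crossing ⟩
    tutte L c es + (tutte Lₑ (pred c) es + tutte L_f (pred c) ((p , q) ∷ es)) ≈⟨ +-assoc _ _ _ ⟨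
    tutte L c es + tutte Lₑ (pred c) es + tutte L_f (pred c) ((p , q) ∷ es)
      ≡⟨ ≡.trans (tutte-link L c u v ((p , q) ∷ es) f≢)
        (cong (_+ tutte L_f (pred c) ((p , q) ∷ es)) (tutte-link L c p q es e≢)) ⟨
    tutte L c ((u , v) ∷ (p , q) ∷ es) ∎
    where
    Lₑ L_f : V → ℕ
    Lₑ = merge L (p , q)
    L_f = merge L (u , v)
    crossing : tutte L_f (pred c) es + tutte Lₑ (pred c) ((u , v) ∷ es) ≈ tutte Lₑ (pred c) es + tutte L_f
      (pred c) ((p , q) ∷ es)
    crossing with Lₑ u ℕ.≟ Lₑ v
    ... | yes eq = begin
      tutte L_f (pred c) es + tutte Lₑ (pred c) ((u , v) ∷ es)
        ≡⟨ cong (tutte L_f (pred c) es +_) (tutte-loop Lₑ (pred c) u v es eq) ⟩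
      tutte L_f (pred c) es + y * tutte Lₑ (pred c) es
        ≈⟨ +-cong (tutte-∼ L_f Lₑ (pred c) es (ge , le)) (*-congˡ (tutte-∼ Lₑ L_f (pred c) es (le , ge))) ⟩
      tutte Lₑ (pred c) es + y * tutte L_f (pred c) es
        ≡⟨ cong (tutte Lₑ (pred c) es +_) (tutte-loop L_f (pred c) p q es eq′) ⟨
      tutte Lₑ (pred c) es + tutte L_f (pred c) ((p , q) ∷ es) ∎
      where
      eq′ : L_f p ≡ L_f q
      eq′ = parallel L p q f≢ eq
      le : Lₑ ⊑ L_f
      le = merge-least L L_f p q (⊑-merge L (u , v)) eq′
      ge : L_f ⊑ Lₑ
      ge = merge-least L Lₑ u v (⊑-merge L (p , q)) eq
    ... | no ne = begin
      tutte L_f (pred c) es + tutte Lₑ (pred c) ((u , v) ∷ es)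
        ≡⟨ cong (tutte L_f (pred c) es +_) (tutte-link Lₑ (pred c) u v es ne) ⟩
      tutte L_f (pred c) es + (tutte Lₑ (pred c) es + tutte (merge Lₑ (u , v)) (pred (pred c)) es)
        ≈⟨ +-exchange _ _ _ ⟩
      tutte Lₑ (pred c) es + (tutte L_f (pred c) es + tutte (merge Lₑ (u , v)) (pred (pred c)) es)
        ≈⟨ +-congˡ (+-congˡ (tutte-∼ (merge Lₑ (u , v)) (merge L_f (p , q)) (pred (pred c)) es
          (merge-exchange L (p , q) (u , v) , merge-exchange L (u , v) (p , q)))) ⟩
      tutte Lₑ (pred c) es + (tutte L_f (pred c) es + tutte (merge L_f (p , q)) (pred (pred c)) es)
        ≡⟨ cong (tutte Lₑ (pred c) es +_) (tutte-link L_f (pred c) p q es (ne ∘ parallel L u v e≢)) ⟨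
      tutte Lₑ (pred c) es + tutte L_f (pred c) ((p , q) ∷ es) ∎

  ≅-↭ : ∀ {es fs} → es ↭ fs → es ≅ fs
  ≅-↭ ↭.refl         L c = refl
  ≅-↭ (prep {xs = es} {ys = fs} e p) L c = ≅-prefix [ e ] {es} {fs} (≅-↭ p) L c
  ≅-↭ (swap {xs = es} {ys = fs} e f p) L c =
    trans (≅-prefix (e ∷ f ∷ []) {es} {fs} (≅-↭ p) L c) (≅-exchange e f fs L c)
  ≅-↭ (↭.trans p q)  L c = trans (≅-↭ p L c) (≅-↭ q L c)

  -- Permuting the vertices permutes the edges of the complete graph and reverses some; a
  -- transposition of neighbours reverses just the edge between them.
  pairs-↭ : ∀ {vs ws} → vs ↭ ws → pairs vs ≅ pairs ws
  pairs-↭ ↭.refl L c = refl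
  pairs-↭ (↭.trans p q) L c = trans (pairs-↭ p L c) (pairs-↭ q L c)
  pairs-↭ (prep {xs = vs} {ys = ws} v p) L c =
    trans (≅-↭ (↭.++⁺ʳ (pairs vs) (↭.map⁺ (v ,_) p)) L c)
      (≅-prefix (map (v ,_) ws) {pairs vs} {pairs ws} (pairs-↭ p) L c)
  pairs-↭ (swap {xs = vs} {ys = ws} u v p) L c = begin
    tutte L c ((u , v) ∷ (map (u ,_) vs ++ (map (v ,_) vs ++ pairs vs)))
      ≈⟨ ≅-flip u v (map (u ,_) vs ++ (map (v ,_) vs ++ pairs vs)) L c ⟩
    tutte L c ((v , u) ∷ (map (u ,_) vs ++ (map (v ,_) vs ++ pairs vs)))
      ≈⟨ ≅-↭ (prep (v , u) (↭.shifts (map (u ,_) vs) (map (v ,_) vs))) L c ⟩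
    tutte L c ((v , u) ∷ (map (v ,_) vs ++ (map (u ,_) vs ++ pairs vs)))
      ≈⟨ ≅-↭ (prep (v , u) (↭.++⁺ (↭.map⁺ (v ,_) p) (↭.++⁺ʳ (pairs vs) (↭.map⁺ (u ,_) p)))) L c ⟩
    tutte L c ((v , u) ∷ (map (v ,_) ws ++ (map (u ,_) ws ++ pairs vs)))
      ≈⟨ ≅-prefix ((v , u) ∷ map (v ,_) ws) {map (u ,_) ws ++ pairs vs} {map (u ,_) ws ++ pairs ws}
           (≅-prefix (map (u ,_) ws) {pairs vs} {pairs ws} (pairs-↭ p)) L c ⟩
    tutte L c ((v , u) ∷ (map (v ,_) ws ++ (map (u ,_) ws ++ pairs ws))) ∎

AllPairs-resp-↭ : ∀ {a r} {A : Set a} {R : A → A → Set r} → Symmetric R →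
  ∀ {xs ys} → xs ↭ ys → AllPairs R xs → AllPairs R ys
AllPairs-resp-↭ s ↭.refl ps = ps
AllPairs-resp-↭ s (prep x p) (px ∷ ps) = ↭.All-resp-↭ p px ∷ AllPairs-resp-↭ s p ps
AllPairs-resp-↭ s (swap x y p) ((xy ∷ px) ∷ py ∷ ps) =
  (s xy ∷ ↭.All-resp-↭ p py) ∷ ↭.All-resp-↭ p px ∷ AllPairs-resp-↭ s p ps
AllPairs-resp-↭ s (↭.trans p q) ps = AllPairs-resp-↭ s q (AllPairs-resp-↭ s p ps)

-- Exploration of the complete graph.

module Explore {c ℓ} (R : CommutativeRing c ℓ) (x y : CommutativeRing.Carrier R) {v} {V : Set v} where
  open CommutativeRing R
  open RingEval R
  open Sums R
  open Weights R x y
  open Kernels {V = V}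
  open Graphs R x y {V = V}
  open import Relation.Binary.Reasoning.Setoid setoid

  tutte-loops : ∀ L c v as es → All (λ a → L a ≡ L v) as →
    tutte L c (map (v ,_) as ++ es) ≈ pow y (length as) * tutte L c es
  tutte-loops L c v []       es []         = sym (*-identityˡ _)
  tutte-loops L c v (a ∷ as) es (eq ∷ eqs) = begin
    tutte L c ((v , a) ∷ map (v ,_) as ++ es) ≡⟨ tutte-loop L c v a (map (v ,_) as ++ es) (≡.sym eq) ⟩
    y * tutte L c (map (v ,_) as ++ es) ≈⟨ *-congˡ (tutte-loops L c v as es eqs) ⟩
    y * (pow y (length as) * tutte L c es) ≈⟨ *-assoc _ _ _ ⟨
    y * pow y (length as) * tutte L c es ∎

  Separated : (V → ℕ) → List V → Set v
  Separated L = AllPairs (λ a b → L a ≢ L b)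

  separated-merge : ∀ L u r vs → All (λ a → L a ≢ L r) vs → Separated L vs → Separated (merge L (u , r)) vs
  separated-merge L u r [] [] [] = []
  separated-merge L u r (a ∷ vs) (a≢ ∷ vs≢) (s ∷ ss) =
    All.zipWith (λ (b≢ , ab) eq → ab (≡.trans (≡.sym (merge-miss L a≢)) (≡.trans eq (merge-miss L b≢))))
      (vs≢ , s)
    ∷ separated-merge L u r vs vs≢ ss

  -- explore scans the edges at an active vertex v, the vertices as being already connected to v and rs being
  -- isolated; exploreEdges reads those edges one at a time, us being the vertices left unconnected so far.
  -- Here n is the number of remaining vertices and f that of the components already completed.
  explore : ∀ n f L v as rs → suc (length as ℕ.+ length rs) ≡ n → All (λ a → L a ≡ L v) as →
    Separated L (v ∷ rs) →
    tutte L (f ℕ.+ length rs) (pairs (v ∷ as ++ rs)) ≈ pow z f * exploration (suc (length as)) (length rs)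

  exploreEdges : ∀ n f L v as rs us {vs} → length as ℕ.+ (length rs ℕ.+ length us) ≡ n → vs ↭ as ++ rs ++ us →
    All (λ a → L a ≡ L v) as → Separated L (v ∷ rs ++ us) →
    tutte L (f ℕ.+ (length rs ℕ.+ length us)) (map (v ,_) rs ++ pairs vs) ≈
    pow z f * binomial (length rs) (λ k j → exploration (length as ℕ.+ k) (j ℕ.+ length us))

  explore zero    f L v as rs () same sep
  explore (suc n) f L v as rs eq same sep = begin
    tutte L (f ℕ.+ r) (map (v ,_) (as ++ rs) ++ pairs (as ++ rs))
      ≡⟨ cong (tutte L (f ℕ.+ r)) (≡.trans (cong (_++ pairs (as ++ rs)) (map-++ (v ,_) as rs))
        (++-assoc (map (v ,_) as) _ _)) ⟩
    tutte L (f ℕ.+ r) (map (v ,_) as ++ map (v ,_) rs ++ pairs (as ++ rs))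
      ≈⟨ tutte-loops L (f ℕ.+ r) v as _ same ⟩
    pow y a * tutte L (f ℕ.+ r) (map (v ,_) rs ++ pairs (as ++ rs))
      ≡⟨ cong (λ m → pow y a * tutte L (f ℕ.+ m) (map (v ,_) rs ++ pairs (as ++ rs)))
        (≡.sym (ℕ.+-identityʳ r)) ⟩
    pow y a * tutte L (f ℕ.+ (r ℕ.+ 0)) (map (v ,_) rs ++ pairs (as ++ rs))
      ≈⟨ *-congˡ (exploreEdges n f L v as rs []
        (≡.trans (cong (a ℕ.+_) (ℕ.+-identityʳ r)) (ℕ.suc-injective eq))
           (↭.↭-reflexive (cong (as ++_) (≡.sym (++-identityʳ rs)))) same
             (subst (λ ts → Separated L (v ∷ ts)) (≡.sym (++-identityʳ rs)) sep)) ⟩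
    pow y a * (pow z f * binomial r (λ k j → exploration (a ℕ.+ k) (j ℕ.+ 0)))
      ≈⟨ x∙yz≈y∙xz _ _ _ ⟩
    pow z f * (pow y a * binomial r (λ k j → exploration (a ℕ.+ k) (j ℕ.+ 0)))
      ≈⟨ *-congˡ (*-congˡ (binomial-cong r
        (λ k j _ → reflexive (cong (exploration (a ℕ.+ k)) (ℕ.+-identityʳ j))))) ⟩
    pow z f * (pow y a * binomial r (λ k j → exploration (a ℕ.+ k) j))
      ≈⟨ *-congˡ (exploration-suc a r) ⟨
    pow z f * exploration (suc a) r ∎
    where
    a = length as
    r = length rs
    open import Algebra.Properties.CommutativeSemigroup *-commutativeSemigroup using (x∙yz≈y∙xz)

  exploreEdges n f L v [] [] [] _ p same sep with ↭.↭-empty-inv p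
  ... | ≡.refl = begin
    pow z (f ℕ.+ 0) ≡⟨ cong (pow z) (ℕ.+-identityʳ f) ⟩
    pow z f ≈⟨ *-identityʳ _ ⟨
    pow z f * 1# ∎
  -- No active vertex is left: the component of `v` is complete, `f` increases, and the exploration
  -- restarts from the untouched vertex `u`.
  exploreEdges n f L v [] [] (u ∷ us) {vs} eq p same (_ ∷ sep) = begin
    tutte L (f ℕ.+ suc m) (pairs vs) ≈⟨ pairs-↭ p L (f ℕ.+ suc m) ⟩
    tutte L (f ℕ.+ suc m) (pairs (u ∷ us)) ≡⟨ cong (λ e → tutte L e (pairs (u ∷ us))) (ℕ.+-suc f m) ⟩
    tutte L (suc f ℕ.+ m) (pairs (u ∷ us)) ≈⟨ explore n (suc f) L u [] us eq [] sep ⟩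
    z * pow z f * (1# * classicalSum 0 m m) ≈⟨ *-cong (*-comm _ _) (*-identityˡ _) ⟩
    pow z f * z * classicalSum 0 m m ≈⟨ *-assoc _ _ _ ⟩
    pow z f * (z * classicalSum 0 m m) ∎
    where m = length us
  -- All edges at `v` are read; the active vertex `a`, in the same class, takes over its role.
  exploreEdges n f L v (a ∷ as) [] us {vs} eq p (a≡v ∷ same) (v≢ ∷ sep) = begin
    tutte L (f ℕ.+ length us) (pairs vs) ≈⟨ pairs-↭ p L (f ℕ.+ length us) ⟩
    tutte L (f ℕ.+ length us) (pairs (a ∷ as ++ us))
      ≈⟨ explore n f L a as us eq (All.map (λ e → ≡.trans e (≡.sym a≡v)) same)
        (All.map (λ ne e → ne (≡.trans (≡.sym a≡v) e)) v≢ ∷ sep) ⟩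
    pow z f * exploration (suc (length as)) (length us)
      ≡⟨ cong (λ k → pow z f * exploration (suc k) (length us)) (ℕ.+-identityʳ (length as)) ⟨
    pow z f * exploration (suc (length as ℕ.+ 0)) (length us) ∎
  -- Deleting the edge to `r` moves `r` to the untouched vertices, contracting it moves `r` to the
  -- active ones; these are the two halves of `binomial (suc m)`. As the vertices change lists, `vs`
  -- is kept fixed and compared by a permutation.
  exploreEdges n f L v as (r ∷ rs) us {vs} eq p same ((v≢r ∷ v≢) ∷ r≢ ∷ sep) = begin
    tutte L c′ ((v , r) ∷ es) ≡⟨ tutte-link L c′ v r es v≢r ⟩
    tutte L c′ es + tutte L′ (pred c′) es ≈⟨ +-cong skipped joined ⟩
    pow z f * binomial m (λ k j → exploration (length as ℕ.+ k) (suc j ℕ.+ length us)) +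
      pow z f * binomial m (λ k j → exploration (length as ℕ.+ suc k) (j ℕ.+ length us)) ≈⟨ distribˡ _ _ _ ⟨
    pow z f * binomial (suc m) (λ k j → exploration (length as ℕ.+ k) (j ℕ.+ length us)) ∎
    where
    m = length rs
    es = map (v ,_) rs ++ pairs vs
    c′ = f ℕ.+ (suc m ℕ.+ length us)
    L′ : V → ℕ
    L′ = merge L (v , r)
    moved : r ∷ rs ++ us ↭ rs ++ r ∷ us
    moved = ↭-sym (↭.shift r rs us)
    lens : m ℕ.+ suc (length us) ≡ suc m ℕ.+ length us
    lens = ℕ.+-suc m (length us)
    skipped : tutte L c′ es ≈
      pow z f * binomial m (λ k j → exploration (length as ℕ.+ k) (suc j ℕ.+ length us))
    skipped = begin
      tutte L c′ es ≡⟨ cong (λ l → tutte L (f ℕ.+ l) es) (≡.sym lens) ⟩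
      tutte L (f ℕ.+ (m ℕ.+ suc (length us))) es
        ≈⟨ exploreEdges n f L v as rs (r ∷ us) (≡.trans (cong (length as ℕ.+_) lens) eq)
          (↭-trans p (↭.++⁺ˡ as moved)) same
             (AllPairs-resp-↭ (λ ne e → ne (≡.sym e)) (prep v moved) ((v≢r ∷ v≢) ∷ r≢ ∷ sep)) ⟩
      pow z f * binomial m (λ k j → exploration (length as ℕ.+ k) (j ℕ.+ suc (length us)))
        ≈⟨ *-congˡ (binomial-cong m (λ k j _ →
          reflexive (cong (exploration (length as ℕ.+ k)) (ℕ.+-suc j (length us))))) ⟩
      pow z f * binomial m (λ k j → exploration (length as ℕ.+ k) (suc j ℕ.+ length us)) ∎
    joined : tutte L′ (pred c′) es ≈
      pow z f * binomial m (λ k j → exploration (length as ℕ.+ suc k) (j ℕ.+ length us))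
    joined = begin
      tutte L′ (pred c′) es ≡⟨ cong (λ l → tutte L′ (pred l) es) (ℕ.+-suc f (m ℕ.+ length us)) ⟩
      tutte L′ (f ℕ.+ (m ℕ.+ length us)) es
        ≈⟨ exploreEdges n f L′ v (r ∷ as) rs us
             (≡.trans (≡.sym (ℕ.+-suc (length as) (m ℕ.+ length us))) eq)
               (↭-trans p (↭.shift r as (rs ++ us)))
             (≡.sym (merge-joins L v r) ∷ All.map (⊑-merge L (v , r)) same)
             (separated-merge L v r (v ∷ rs ++ us) (v≢r ∷ All.map (λ ne e → ne (≡.sym e)) r≢) (v≢ ∷ sep)) ⟩
      pow z f * binomial m (λ k j → exploration (suc (length as ℕ.+ k)) (j ℕ.+ length us))
        ≈⟨ *-congˡ (binomial-cong m (λ k j _ →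
          reflexive (cong (λ a → exploration a (j ℕ.+ length us)) (≡.sym (ℕ.+-suc (length as) k))))) ⟩
      pow z f * binomial m (λ k j → exploration (length as ℕ.+ suc k) (j ℕ.+ length us)) ∎

-- Rank and nullity of an edge set

length-filterᵇ-split : ∀ {a} {A : Set a} (p q : A → Bool) xs → length (filterᵇ p xs) ≡
  length (filterᵇ (λ x → p x ∧ not (q x)) xs) ℕ.+ length (filterᵇ (λ x → p x ∧ q x) xs)
length-filterᵇ-split p q [] = ≡.refl
length-filterᵇ-split p q (x ∷ xs) with p x | q x
... | false | _     = length-filterᵇ-split p q xs
... | true  | false = cong suc (length-filterᵇ-split p q xs)
... | true  | true  = ≡.trans (cong suc (length-filterᵇ-split p q xs)) (≡.sym (ℕ.+-suc _ _))

indicator : ∀ {n} → Fin n → Fin n → Bool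
indicator k i = toℕ k ≡ᵇ toℕ i

occurs-once : ∀ {n} (k : Fin n) → length (filterᵇ (indicator k) (allFin n)) ≡ 1
occurs-once {suc n} zero    = cong (λ l → suc (length l))
  (filterᵇ-false {p = indicator {suc n} zero} {xs = tabulate {n = n} suc}
    (All.tabulate⁺ {f = Fin.suc} (λ _ → ≡.refl)))
occurs-once {suc n} (suc k) = begin
  length (filterᵇ (indicator (suc k)) (tabulate suc))
    ≡⟨ cong (λ l → length (filterᵇ (indicator (suc k)) l)) (map-tabulate (λ i → i) suc) ⟨
  length (filterᵇ (indicator (suc k)) (map suc (allFin n)))
    ≡⟨ cong length (filterᵇ-map (indicator (suc k)) suc (allFin n)) ⟩
  length (map Fin.suc (filterᵇ (indicator k) (allFin n)))
    ≡⟨ length-map Fin.suc (filterᵇ (indicator k) (allFin n)) ⟩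
  length (filterᵇ (indicator k) (allFin n)) ≡⟨ occurs-once k ⟩
  1 ∎
  where open ≡.≡-Reasoning

module _ {n : ℕ} where

  Labelling : Set
  Labelling = Fin n → Fin n

  -- Every label is then a vertex of its own class, so the fixed points counted by `roots` represent
  -- the classes.
  Idempotent : Labelling → Set
  Idempotent lab = ∀ i → lab (lab i) ≡ lab i

  roots : Labelling → ℕ
  roots lab = length (filterᵇ (λ i → toℕ (lab i) ≡ᵇ toℕ i) (allFin n))

  mergeLab-hit : ∀ (lab : Labelling) u v w → lab w ≡ lab v → mergeLab lab (u , v) w ≡ lab u
  mergeLab-hit lab u v w eq rewrite eq | ≡ᵇ-refl (toℕ (lab v)) = ≡.refl

  mergeLab-miss : ∀ (lab : Labelling) u v w → lab w ≢ lab v → mergeLab lab (u , v) w ≡ lab w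
  mergeLab-miss lab u v w ne rewrite ≢⇒≡ᵇ≡false (ne ∘ Fin.toℕ-injective) = ≡.refl

  mergeLab-loop : ∀ (lab : Labelling) u v → lab u ≡ lab v → ∀ w → mergeLab lab (u , v) w ≡ lab w
  mergeLab-loop lab u v loop w with lab w Fin.≟ lab v
  ... | yes eq = ≡.trans (mergeLab-hit lab u v w eq) (≡.trans loop (≡.sym eq))
  ... | no ne  = mergeLab-miss lab u v w ne

  mergeLab-cong : ∀ (lab lab′ : Labelling) → (∀ i → lab i ≡ lab′ i) → ∀ e i →
    mergeLab lab e i ≡ mergeLab lab′ e i
  mergeLab-cong lab lab′ eq (u , v) i rewrite eq i | eq u | eq v = ≡.refl

  foldl-mergeLab-cong : ∀ (lab lab′ : Labelling) → (∀ i → lab i ≡ lab′ i) → ∀ A i →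
    foldl mergeLab lab A i ≡ foldl mergeLab lab′ A i
  foldl-mergeLab-cong lab lab′ eq []      = eq
  foldl-mergeLab-cong lab lab′ eq (e ∷ A) =
    foldl-mergeLab-cong (mergeLab lab e) (mergeLab lab′ e) (mergeLab-cong lab lab′ eq e) A

  roots-cong : ∀ (lab lab′ : Labelling) → (∀ i → lab i ≡ lab′ i) → roots lab ≡ roots lab′
  roots-cong lab lab′ eq = cong length (filterᵇ-cong (λ i → cong (λ l → toℕ l ≡ᵇ toℕ i) (eq i)) (allFin n))

  mergeLab-merge : ∀ (lab : Labelling) e i → toℕ (mergeLab lab e i) ≡ Kernels.merge (toℕ ∘ lab) e i
  mergeLab-merge lab (u , v) i with toℕ (lab i) ≡ᵇ toℕ (lab v)
  ... | true  = ≡.refl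
  ... | false = ≡.refl

  settles : ∀ (lab : Labelling) {i k} → lab i ≡ k → lab k ≡ k → lab (lab i) ≡ lab i
  settles lab eq fix = ≡.trans (cong lab eq) (≡.trans fix (≡.sym eq))

  mergeLab-idempotent : ∀ lab e → Idempotent lab → Idempotent (mergeLab lab e)
  mergeLab-idempotent lab (u , v) idem i with lab i Fin.≟ lab v | lab u Fin.≟ lab v
  ... | yes p | yes q = settles (mergeLab lab (u , v)) (mergeLab-hit lab u v i p)
    (mergeLab-hit lab u v (lab u) (≡.trans (idem u) q))
  ... | yes p | no q = settles (mergeLab lab (u , v)) (mergeLab-hit lab u v i p)
    (≡.trans (mergeLab-miss lab u v (lab u) (q ∘ ≡.trans (≡.sym (idem u)))) (idem u))
  ... | no p | _ = settles (mergeLab lab (u , v)) (mergeLab-miss lab u v i p)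
    (≡.trans (mergeLab-miss lab u v (lab i) (p ∘ ≡.trans (≡.sym (idem i)))) (idem i))

  fixedᵇ : Labelling → Fin n → Bool
  fixedᵇ lab i = toℕ (lab i) ≡ᵇ toℕ i

  ≡⇒toℕ≡ᵇ : ∀ (i j : Fin n) → i ≡ j → (toℕ i ≡ᵇ toℕ j) ≡ true
  ≡⇒toℕ≡ᵇ i j ≡.refl = ≡ᵇ-refl (toℕ i)

  ≢⇒toℕ≢ᵇ : ∀ (i j : Fin n) → i ≢ j → (toℕ i ≡ᵇ toℕ j) ≡ false
  ≢⇒toℕ≢ᵇ i j ne = ≢⇒≡ᵇ≡false (ne ∘ Fin.toℕ-injective)

  -- A link destroys exactly one root, namely the label of the absorbed class.
  roots-link : ∀ lab u v → Idempotent lab → lab u ≢ lab v → suc (roots (mergeLab lab (u , v))) ≡ roots lab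
  roots-link lab u v idem ne = ≡.sym (begin
    roots lab ≡⟨ length-filterᵇ-split (fixedᵇ lab) absorbed (allFin n) ⟩
    length (filterᵇ (λ i → fixedᵇ lab i ∧ not (absorbed i)) (allFin n)) ℕ.+
      length (filterᵇ (λ i → fixedᵇ lab i ∧ absorbed i) (allFin n))
      ≡⟨ cong₂ ℕ._+_ (cong length (filterᵇ-cong survives (allFin n)))
        (≡.trans (cong length (filterᵇ-cong dies (allFin n))) (occurs-once (lab v))) ⟩
    roots (mergeLab lab (u , v)) ℕ.+ 1 ≡⟨ ℕ.+-comm _ 1 ⟩
    suc (roots (mergeLab lab (u , v))) ∎)
    where
    open ≡.≡-Reasoning
    absorbed : Fin n → Bool
    absorbed i = toℕ (lab v) ≡ᵇ toℕ i
    dies : ∀ i → fixedᵇ lab i ∧ absorbed i ≡ absorbed i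
    dies i with lab v Fin.≟ i
    ... | yes ≡.refl = cong (_∧ absorbed i) (≡⇒toℕ≡ᵇ (lab i) i (idem v))
    ... | no ne      = ≡.trans (cong (fixedᵇ lab i ∧_) (≢⇒toℕ≢ᵇ (lab v) i ne))
      (≡.trans (∧-zeroʳ _) (≡.sym (≢⇒toℕ≢ᵇ (lab v) i ne)))
    survives : ∀ i → fixedᵇ lab i ∧ not (absorbed i) ≡ fixedᵇ (mergeLab lab (u , v)) i
    survives i with lab i Fin.≟ i | lab i Fin.≟ lab v
    ... | yes p | yes q = ≡.trans (cong₂ (λ a b → a ∧ not b) (≡⇒toℕ≡ᵇ (lab i) i p)
      (≡⇒toℕ≡ᵇ (lab v) i (≡.trans (≡.sym q) p)))
      (≡.sym (≢⇒toℕ≢ᵇ (mergeLab lab (u , v) i) i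
        (λ e → ne (≡.trans (≡.sym (mergeLab-hit lab u v i q)) (≡.trans e (≡.trans (≡.sym p) q))))))
    ... | yes p | no q  = ≡.trans (cong₂ (λ a b → a ∧ not b) (≡⇒toℕ≡ᵇ (lab i) i p)
      (≢⇒toℕ≢ᵇ (lab v) i (λ e → q (≡.trans p (≡.sym e)))))
      (≡.sym (≡⇒toℕ≡ᵇ (mergeLab lab (u , v) i) i (≡.trans (mergeLab-miss lab u v i q) p)))
    ... | no p  | no q  = ≡.trans (cong (_∧ not (absorbed i)) (≢⇒toℕ≢ᵇ (lab i) i p))
      (≡.sym (≢⇒toℕ≢ᵇ (mergeLab lab (u , v) i) i (p ∘ ≡.trans (≡.sym (mergeLab-miss lab u v i q)))))
    ... | no p  | yes q = ≡.trans (cong (_∧ not (absorbed i)) (≢⇒toℕ≢ᵇ (lab i) i p))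
      (≡.sym (≢⇒toℕ≢ᵇ (mergeLab lab (u , v) i) i
        (λ e → let eq = ≡.trans (≡.sym (mergeLab-hit lab u v i q)) e in
        p (≡.trans (cong lab (≡.sym eq)) (≡.trans (idem u) eq)))))

  -- The number of edges closing a cycle when the edges are added in order, a recursive form of the
  -- number of edges minus the rank.
  nullity : Labelling → List (Fin n × Fin n) → ℕ
  nullity lab []            = 0
  nullity lab ((u , v) ∷ A) with lab u Fin.≟ lab v
  ... | yes _ = suc (nullity lab A)
  ... | no  _ = nullity (mergeLab lab (u , v)) A

  -- Each edge is either a loop, raising the nullity, or a link, destroying one root.
  roots-nullity : ∀ lab A → Idempotent lab → roots (foldl mergeLab lab A) ℕ.+ length A ≡ roots lab ℕ.+ nullity
    lab A
  roots-nullity lab [] idem = ≡.refl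
  roots-nullity lab ((u , v) ∷ A) idem with lab u Fin.≟ lab v
  -- The fold merges along the loop as well, while `nullity` keeps `lab`; the two labellings agree
  -- pointwise.
  ... | yes eq = ≡.trans (cong (ℕ._+ suc (length A))
    (roots-cong (foldl mergeLab lab′ A) (foldl mergeLab lab A)
        (foldl-mergeLab-cong lab′ lab (mergeLab-loop lab u v eq) A)))
    (≡.trans (ℕ.+-suc _ _) (≡.trans (cong suc (roots-nullity lab A idem)) (≡.sym (ℕ.+-suc _ _))))
    where lab′ = mergeLab lab (u , v)
  ... | no ne = ≡.trans (ℕ.+-suc _ _)
    (≡.trans (cong suc (roots-nullity lab′ A (mergeLab-idempotent lab (u , v) idem)))
    (cong (ℕ._+ nullity lab′ A) (roots-link lab u v idem ne)))
    where lab′ = mergeLab lab (u , v)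

  mergeLab-keeps : ∀ (lab : Labelling) e {a b} → lab a ≡ lab b → mergeLab lab e a ≡ mergeLab lab e b
  mergeLab-keeps lab (u , v) eq = cong (λ l → if toℕ l ≡ᵇ toℕ (lab v) then lab u else l) eq

  foldl-keeps : ∀ (lab : Labelling) A {a b} → lab a ≡ lab b → foldl mergeLab lab A a ≡ foldl mergeLab lab A b
  foldl-keeps lab []      eq = eq
  foldl-keeps lab (e ∷ A) eq = foldl-keeps (mergeLab lab e) A (mergeLab-keeps lab e eq)

  foldl-joins : ∀ (lab : Labelling) (A : List (Fin n × Fin n)) →
    All (λ (u , v) → foldl mergeLab lab A u ≡ foldl mergeLab lab A v) A
  foldl-joins lab []            = []
  foldl-joins lab ((u , v) ∷ A) =
    foldl-keeps (mergeLab lab (u , v)) A (≡.trans source (≡.sym (mergeLab-hit lab u v v ≡.refl)))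
    ∷ foldl-joins (mergeLab lab (u , v)) A
    where
    source : mergeLab lab (u , v) u ≡ lab u
    source with lab u Fin.≟ lab v
    ... | yes eq = mergeLab-hit lab u v u eq
    ... | no ne  = mergeLab-miss lab u v u ne

roots-id : ∀ n → roots {n} id ≡ n
roots-id n = ≡.trans (cong length (filterᵇ-true (All.universal (λ i → ≡ᵇ-refl (toℕ i)) (allFin n))))
  (length-tabulate id)

-- The edges of the complete graph.

edgesFrom : ∀ {n} → List (Fin n) → List (Fin n) → List (Fin n × Fin n)
edgesFrom vs us = concatMap (λ i → map (i ,_) (filterᵇ (λ j → toℕ i <ᵇ toℕ j) vs)) us

-- The filter always runs over all vertices while the outer list shrinks. The vertices `ps` already
-- passed are below all those of `us` and contribute no edge.
edgesFrom-pairs : ∀ {n} (ps us : List (Fin n)) → AllPairs (λ i j → toℕ i < toℕ j) us →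
  All (λ u → filterᵇ (λ j → toℕ u <ᵇ toℕ j) ps ≡ []) us → edgesFrom (ps ++ us) us ≡ pairs us
edgesFrom-pairs ps [] [] [] = ≡.refl
edgesFrom-pairs ps (u ∷ us) (u< ∷ sorted) (none ∷ nones) = cong₂ _++_ (cong (map (u ,_)) above) (begin
  edgesFrom (ps ++ u ∷ us) us ≡⟨ cong (λ vs → edgesFrom vs us) (≡.sym (++-assoc ps [ u ] us)) ⟩
  edgesFrom ((ps ++ [ u ]) ++ us) us
    ≡⟨ edgesFrom-pairs (ps ++ [ u ]) us sorted
      (All.zipWith (λ {t} (none , lt) → earlier t none lt) (nones , u<)) ⟩
  pairs us ∎)
  where
  open ≡.≡-Reasoning
  earlier : ∀ t → filterᵇ (λ j → toℕ t <ᵇ toℕ j) ps ≡ [] → toℕ u < toℕ t →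
    filterᵇ (λ j → toℕ t <ᵇ toℕ j) (ps ++ [ u ]) ≡ []
  earlier t none lt = ≡.trans (filter-++ (T? ∘ λ j → toℕ t <ᵇ toℕ j) ps [ u ])
    (cong₂ _++_ none (filterᵇ-false {p = λ j → toℕ t <ᵇ toℕ j} {xs = [ u ]} (≤⇒<ᵇ≡false (ℕ.<⇒≤ lt) ∷ [])))
  above : filterᵇ (λ j → toℕ u <ᵇ toℕ j) (ps ++ u ∷ us) ≡ us
  above = ≡.trans (filter-++ (T? ∘ λ j → toℕ u <ᵇ toℕ j) ps (u ∷ us)) (cong₂ _++_ none after)
    where
    after : filterᵇ (λ j → toℕ u <ᵇ toℕ j) (u ∷ us) ≡ us
    after rewrite ≤⇒<ᵇ≡false (ℕ.≤-refl {toℕ u}) = filterᵇ-true (All.map <⇒<ᵇ≡true u<)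

edgesK-pairs : ∀ n → edgesK n ≡ pairs (allFin n)
edgesK-pairs n = edgesFrom-pairs [] (allFin n) (AllPairs.tabulate⁺-< (λ lt → lt))
  (All.universal (λ _ → ≡.refl) (allFin n))

-- The edges at vertex 0 come first in `pairs` and already join it to every other vertex, so all
-- labels coincide and there is one root.
components-edgesK : ∀ n → components (suc n) (edgesK (suc n)) ≡ 1
components-edgesK n = ≡.trans (cong length
  (filterᵇ-cong (λ i → cong (λ l → toℕ l ≡ᵇ toℕ i) (constant i)) (allFin (suc n)))) (occurs-once (lab zero))
  where
  lab : Fin (suc n) → Fin (suc n)
  lab = labels (edgesK (suc n))
  joined : All (λ (u , v) → lab u ≡ lab v) (map (zero ,_) (tabulate suc))
  joined = All.++⁻ˡ _ (subst (All (λ (u , v) → lab u ≡ lab v)) (edgesK-pairs (suc n))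
    (foldl-joins id (edgesK (suc n))))
  constant : ∀ i → lab i ≡ lab zero
  constant zero    = ≡.refl
  constant (suc i) = ≡.sym (All.tabulate⁻ (All.map⁻ joined) i)

-- The subset expansion of the Tutte polynomial.

module TutteK {c ℓ} (R : CommutativeRing c ℓ) (x y : CommutativeRing.Carrier R) where
  open CommutativeRing R
  open RingEval R
  open Sums R
  open Weights R x y
  open import Relation.Binary.Reasoning.Setoid setoid

  t : Carrier
  t = y - 1#

  1+t≈y : 1# + t ≈ y
  1+t≈y = trans (+-comm 1# t) (trans (+-assoc y (- 1#) 1#) (trans (+-congˡ (-‿inverseˡ 1#)) (+-identityʳ y)))

  module _ {n : ℕ} where
    open Kernels {V = Fin n}
    open Graphs R x y {V = Fin n}

    rankTerm : Labelling → List (Fin n × Fin n) → Carrier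
    rankTerm lab A = pow z (roots (foldl mergeLab lab A) ∸ 1) * pow t (nullity lab A)

    -- The subsets are split by their first edge. A loop only changes the nullity, so both halves
    -- together give `1 + t`, that is `y`; for a link the half with the edge is the sum for the
    -- merged labelling.
    ∑-subsets-tutte : ∀ lab es → Idempotent lab →
      ∑ (subsets es) (rankTerm lab) ≈ tutte (toℕ ∘ lab) (roots lab ∸ 1) es
    ∑-subsets-tutte lab [] idem = trans (+-identityʳ _) (*-identityʳ _)
    ∑-subsets-tutte lab ((u , v) ∷ es) idem = begin
      ∑ (subsets es ++ map ((u , v) ∷_) (subsets es)) (rankTerm lab)
        ≈⟨ trans (∑-++ (subsets es) _) (+-cong (∑-subsets-tutte lab es idem)
          (∑-map (rankTerm lab) ((u , v) ∷_) (subsets es))) ⟩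
      tutte (toℕ ∘ lab) (roots lab ∸ 1) es + ∑ (subsets es) (λ A → rankTerm lab ((u , v) ∷ A))
        ≈⟨ by-link (lab u Fin.≟ lab v) ⟩
      tutte (toℕ ∘ lab) (roots lab ∸ 1) ((u , v) ∷ es) ∎
      where
      lab′ = mergeLab lab (u , v)
      loopTerm : lab u ≡ lab v → ∀ A → rankTerm lab ((u , v) ∷ A) ≈ t * rankTerm lab A
      loopTerm eq A with lab u Fin.≟ lab v
      ... | no ne = ⊥-elim (ne eq)
      ... | yes _ = begin
        pow z (roots (foldl mergeLab lab′ A) ∸ 1) * (t * pow t (nullity lab A))
          ≡⟨ cong (λ r → pow z (r ∸ 1) * (t * pow t (nullity lab A)))
            (roots-cong (foldl mergeLab lab′ A) (foldl mergeLab lab A)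
               (foldl-mergeLab-cong lab′ lab (mergeLab-loop lab u v eq) A)) ⟩
        pow z (roots (foldl mergeLab lab A) ∸ 1) * (t * pow t (nullity lab A)) ≈⟨ x∙yz≈y∙xz _ _ _ ⟩
        t * rankTerm lab A ∎
        where open import Algebra.Properties.CommutativeSemigroup *-commutativeSemigroup using (x∙yz≈y∙xz)
      linkTerm : lab u ≢ lab v → ∀ A → rankTerm lab ((u , v) ∷ A) ≈ rankTerm lab′ A
      linkTerm ne A with lab u Fin.≟ lab v
      ... | yes eq = ⊥-elim (ne eq)
      ... | no _ = refl
      by-link : _ → tutte (toℕ ∘ lab) (roots lab ∸ 1) es + ∑ (subsets es) (λ A → rankTerm lab ((u , v) ∷ A)) ≈
                tutte (toℕ ∘ lab) (roots lab ∸ 1) ((u , v) ∷ es)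
      by-link (yes eq) = begin
        Φ + ∑ (subsets es) (λ A → rankTerm lab ((u , v) ∷ A))
          ≈⟨ +-congˡ (trans (∑-cong (subsets es) (loopTerm eq)) (∑-*ˡ t (subsets es))) ⟩
        Φ + t * ∑ (subsets es) (rankTerm lab)
          ≈⟨ +-cong (sym (*-identityˡ _)) (*-congˡ (∑-subsets-tutte lab es idem)) ⟩
        1# * Φ + t * Φ ≈⟨ distribʳ _ _ _ ⟨
        (1# + t) * Φ ≈⟨ *-congʳ 1+t≈y ⟩
        y * Φ ≡⟨ tutte-loop (toℕ ∘ lab) (roots lab ∸ 1) u v es (cong toℕ eq) ⟨
        tutte (toℕ ∘ lab) (roots lab ∸ 1) ((u , v) ∷ es) ∎
        where Φ = tutte (toℕ ∘ lab) (roots lab ∸ 1) es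
      by-link (no ne) = begin
        Φ + ∑ (subsets es) (λ A → rankTerm lab ((u , v) ∷ A)) ≈⟨ +-congˡ (∑-cong (subsets es) (linkTerm ne)) ⟩
        Φ + ∑ (subsets es) (rankTerm lab′)
          ≈⟨ +-congˡ (∑-subsets-tutte lab′ es (mergeLab-idempotent lab (u , v) idem)) ⟩
        Φ + tutte (toℕ ∘ lab′) (roots lab′ ∸ 1) es
          ≡⟨ cong (λ r → Φ + tutte (toℕ ∘ lab′) (pred (r ∸ 1)) es) (roots-link lab u v idem ne) ⟩
        Φ + tutte (toℕ ∘ lab′) (pred (roots lab ∸ 1)) es
          ≈⟨ +-congˡ (tutte-∼ (toℕ ∘ lab′) (merge (toℕ ∘ lab) (u , v)) (pred (roots lab ∸ 1)) es (le , ge)) ⟩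
        Φ + tutte (merge (toℕ ∘ lab) (u , v)) (pred (roots lab ∸ 1)) es
          ≡⟨ tutte-link (toℕ ∘ lab) (roots lab ∸ 1) u v es (ne ∘ Fin.toℕ-injective) ⟨
        tutte (toℕ ∘ lab) (roots lab ∸ 1) ((u , v) ∷ es) ∎
        where
        Φ = tutte (toℕ ∘ lab) (roots lab ∸ 1) es
        le : toℕ ∘ lab′ ⊑ merge (toℕ ∘ lab) (u , v)
        le {a} {b} eq = ≡.trans (≡.sym (mergeLab-merge lab (u , v) a))
          (≡.trans eq (mergeLab-merge lab (u , v) b))
        ge : merge (toℕ ∘ lab) (u , v) ⊑ toℕ ∘ lab′
        ge {a} {b} eq = ≡.trans (mergeLab-merge lab (u , v) a)
          (≡.trans eq (≡.sym (mergeLab-merge lab (u , v) b)))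

    roots≤n : ∀ (lab : Labelling) → roots lab ≤ n
    roots≤n lab = ℕ.≤-trans (length-filter (T? ∘ fixedᵇ lab) (allFin n)) (ℕ.≤-reflexive (length-tabulate id))

  -- The connected graph on `suc n` vertices has rank `n`, so the exponent of `x` - 1 is the number
  -- of components minus one.
  corank : ∀ n c → c ≤ suc n → n ∸ (suc n ∸ c) ≡ c ∸ 1
  corank n zero    _        = ℕ.m≤n⇒m∸n≡0 (ℕ.n≤1+n n)
  corank n (suc c) (s≤s le) = ℕ.m∸[m∸n]≡n le

  -- The exploration starts at vertex 0 with all other vertices isolated and no component completed.
  -- Its value `exploration 1 n` is the generating function of classical parking functions.
  tutteK-classicalSum : ∀ n → tutteK (suc n) x y ≈ classicalSum 0 n n
  tutteK-classicalSum n = begin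
    tutteK N x y
      ≈⟨ ∑-cong (subsets E) (λ A → reflexive (cong₂ (λ a b → pow z a * pow t b) (rankE A) (nullityE A))) ⟩
    ∑ (subsets E) (rankTerm id) ≈⟨ ∑-subsets-tutte id E (λ _ → ≡.refl) ⟩
    tutte toℕ (roots {N} id ∸ 1) E
      ≡⟨ cong₂ (λ c es → tutte toℕ c es) (≡.trans (cong (_∸ 1) (roots-id N)) (≡.sym others)) (edgesK-pairs N)
        ⟩
    tutte toℕ (length (tabulate {n = n} suc)) (pairs (allFin N))
      ≈⟨ explore N 0 toℕ Fin.zero [] (tabulate suc) (cong suc others) []
        (AllPairs.tabulate⁺ {f = id} (λ ne eq → ne (Fin.toℕ-injective eq))) ⟩
    1# * (1# * classicalSum 0 (length (tabulate {n = n} suc)) (length (tabulate {n = n} suc)))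
      ≈⟨ trans (*-identityˡ _) (*-identityˡ _) ⟩
    classicalSum 0 (length (tabulate {n = n} suc)) (length (tabulate {n = n} suc))
      ≡⟨ cong (λ k → classicalSum 0 k k) others ⟩
    classicalSum 0 n n ∎
    where
    N = suc n
    E = edgesK N
    open Graphs R x y {V = Fin N}
    open Explore R x y {V = Fin N}
    others : length (tabulate {n = n} suc) ≡ n
    others = length-tabulate {n = n} suc
    rankE : ∀ A → rank N E ∸ rank N A ≡ roots (labels A) ∸ 1
    rankE A = ≡.trans (cong (λ k → N ∸ k ∸ rank N A) (components-edgesK n))
      (corank n (roots (labels A)) (roots≤n (labels A)))
    nullityE : ∀ A → length A ∸ rank N A ≡ nullity id A
    nullityE A = ≡.trans (cong (_∸ (N ∸ r)) size) (ℕ.m+n∸m≡n (N ∸ r) (nullity id A))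
      where
      r = roots (labels A)
      size : length A ≡ (N ∸ r) ℕ.+ nullity id A
      size = ℕ.+-cancelˡ-≡ r _ _ (≡.trans (roots-nullity id A (λ _ → ≡.refl))
        (≡.trans (cong (ℕ._+ nullity id A)
        (≡.trans (roots-id N) (≡.sym (ℕ.m+[n∸m]≡n (roots≤n (labels A))))))
          (ℕ.+-assoc r (N ∸ r) (nullity id A))))

-- Comparison of the two sides

compositions-sum : ∀ s m → All (λ xs → sum xs ≡ m) (compositions s m)
compositions-sum zero    zero    = ≡.refl ∷ []
compositions-sum zero    (suc m) = []
compositions-sum (suc s) m       = All.concat⁺ (All.map⁺ (All.map (λ {k} lt → All.map⁺
  (All.map (λ eq → ≡.trans (cong (k ℕ.+_) eq) (ℕ.m+[n∸m]≡n (ℕ.≤-pred lt))) (compositions-sum s (m ∸ k))))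
    (upTo-< (suc m))))

module BothSides {c ℓ} (R : CommutativeRing c ℓ) (x y : CommutativeRing.Carrier R) where
  open CommutativeRing R
  open RingEval R
  open Sums R
  open Weights R x y
  open TutteK R x y
  open import Relation.Binary.Reasoning.Setoid setoid

  natR-+ : ∀ m n → natR (m ℕ.+ n) ≈ natR m + natR n
  natR-+ zero    n = sym (+-identityˡ _)
  natR-+ (suc m) n = trans (+-congˡ (natR-+ m n)) (sym (+-assoc 1# _ _))

  natR-* : ∀ m n → natR (m ℕ.* n) ≈ natR m * natR n
  natR-* zero    n = sym (zeroˡ _)
  natR-* (suc m) n = begin
    natR (n ℕ.+ m ℕ.* n) ≈⟨ natR-+ n (m ℕ.* n) ⟩
    natR n + natR (m ℕ.* n) ≈⟨ +-cong (sym (*-identityˡ _)) (natR-* m n) ⟩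
    1# * natR n + natR m * natR n ≈⟨ distribʳ _ _ _ ⟨
    (1# + natR m) * natR n ∎

  ∑-upTo-last : ∀ f n → ∑ (upTo (suc n)) f ≈ ∑ (upTo n) f + f n
  ∑-upTo-last f n = begin
    ∑ (upTo (suc n)) f ≡⟨ cong (λ l → ∑ l f) (upTo-∷ʳ n) ⟨
    ∑ (upTo n ++ [ n ]) f ≈⟨ ∑-++ (upTo n) [ n ] ⟩
    ∑ (upTo n) f + (f n + 0#) ≈⟨ +-congˡ (+-identityʳ _) ⟩
    ∑ (upTo n) f + f n ∎

  -- Pascal's rule splits each coefficient; `h` collects the part where `k` keeps its value and the
  -- second argument grows by one.
  binomial-C : ∀ m g → ∑ (upTo (suc m)) (λ k → natR (m C k) * g k (m ∸ k)) ≈ binomial m g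
  binomial-C zero g = trans (+-identityʳ _) (trans (*-congʳ (+-identityʳ 1#)) (*-identityˡ _))
  binomial-C (suc m) g = begin
    ∑ (upTo (suc (suc m))) (λ k → natR (suc m C k) * g k (suc m ∸ k)) ≈⟨ ∑-upTo-suc _ (suc m) ⟩
    natR (suc m C 0) * g 0 (suc m) + ∑ (upTo (suc m)) (λ k → natR (suc m C suc k) * g (suc k) (m ∸ k))
      ≈⟨ +-congˡ (trans (∑-cong (upTo (suc m)) pascal) (∑-+ (upTo (suc m)))) ⟩
    natR (m C 0) * g 0 (suc m) + (∑ (upTo (suc m)) (λ k → natR (m C k) * g (suc k) (m ∸ k)) + ∑ (upTo (suc m))
      (λ k → h (suc k)))
      ≈⟨ trans (+-congˡ (+-comm _ _)) (sym (+-assoc _ _ _)) ⟩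
    h 0 + ∑ (upTo (suc m)) (λ k → h (suc k)) + ∑ (upTo (suc m)) (λ k → natR (m C k) * g (suc k) (m ∸ k))
      ≈⟨ +-cong first (binomial-C m (λ k j → g (suc k) j)) ⟩
    binomial m (λ k j → g k (suc j)) + binomial m (λ k j → g (suc k) j) ∎
    where
    h : ℕ → Carrier
    h k = natR (m C k) * g k (suc m ∸ k)
    pascal : ∀ k → natR (suc m C suc k) * g (suc k) (m ∸ k) ≈ natR (m C k) * g (suc k) (m ∸ k) + h (suc k)
    pascal k = trans (*-congʳ (trans (reflexive (cong natR (≡.sym (nCk+nC[k+1]≡[n+1]C[k+1] m k))))
      (natR-+ (m C k) (m C suc k)))) (distribʳ _ _ _)
    first : h 0 + ∑ (upTo (suc m)) (λ k → h (suc k)) ≈ binomial m (λ k j → g k (suc j))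
    first = begin
      h 0 + ∑ (upTo (suc m)) (λ k → h (suc k)) ≈⟨ ∑-upTo-suc h (suc m) ⟨
      ∑ (upTo (suc (suc m))) h ≈⟨ ∑-upTo-last h (suc m) ⟩
      ∑ (upTo (suc m)) h + h (suc m)
        -- The last term has the coefficient `m C suc m`, which is 0.
        ≈⟨ +-congˡ (trans (*-congʳ (reflexive (cong natR (k>n⇒nCk≡0 (ℕ.n<1+n m))))) (zeroˡ _)) ⟩
      ∑ (upTo (suc m)) h + 0# ≈⟨ +-identityʳ _ ⟩
      ∑ (upTo (suc m)) h
        ≈⟨ ∑-congᴬ (All.map (λ {k} lt →
          reflexive (cong (λ j → natR (m C k) * g k j) (ℕ.+-∸-assoc 1 (ℕ.≤-pred lt)))) (upTo-< (suc m))) ⟩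
      ∑ (upTo (suc m)) (λ k → natR (m C k) * g k (suc (m ∸ k))) ≈⟨ binomial-C m (λ k j → g k (suc j)) ⟩
      binomial m (λ k j → g k (suc j)) ∎

  -- The first part `k` of the composition is split off; the multinomial coefficient then factors as
  -- `m C k` times that of the remaining parts, whose sum is `m ∸ k`.
  tutteSide-suc : ∀ s m → tutteSide (suc s) m x y ≈
    binomial m (λ k j → tutteK (suc k) x y * tutteSide s j x y)
  tutteSide-suc s m = begin
    ∑ (compositions (suc s) m) term
      ≈⟨ ∑-concatMap (λ k → map (k ∷_) (compositions s (m ∸ k))) (upTo (suc m)) ⟩
    ∑ (upTo (suc m)) (λ k → ∑ (map (k ∷_) (compositions s (m ∸ k))) term)
      ≈⟨ ∑-congᴬ (All.map (λ {k} lt → part k (ℕ.≤-pred lt)) (upTo-< (suc m))) ⟩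
    ∑ (upTo (suc m)) (λ k → natR (m C k) * (tutteK (suc k) x y * tutteSide s (m ∸ k) x y)) ≈⟨ binomial-C m _ ⟩
    binomial m (λ k j → tutteK (suc k) x y * tutteSide s j x y) ∎
    where
    open import Algebra.Properties.CommutativeSemigroup *-commutativeSemigroup using (interchange)
    term : List ℕ → Carrier
    term xs = natR (multinomial xs) * prodR (map (λ xi → tutteK (suc xi) x y) xs)
    part : ∀ k → k ≤ m → ∑ (map (k ∷_) (compositions s (m ∸ k))) term ≈ natR (m C k) *
      (tutteK (suc k) x y * tutteSide s (m ∸ k) x y)
    part k le = begin
      ∑ (map (k ∷_) (compositions s (m ∸ k))) term ≈⟨ ∑-map term (k ∷_) (compositions s (m ∸ k)) ⟩
      ∑ (compositions s (m ∸ k)) (λ xs → term (k ∷ xs))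
        ≈⟨ ∑-congᴬ (All.map (λ {xs} → peel xs) (compositions-sum s (m ∸ k))) ⟩
      ∑ (compositions s (m ∸ k)) (λ xs → natR (m C k) * tutteK (suc k) x y * term xs)
        ≈⟨ ∑-*ˡ _ (compositions s (m ∸ k)) ⟩
      natR (m C k) * tutteK (suc k) x y * tutteSide s (m ∸ k) x y ≈⟨ *-assoc _ _ _ ⟩
      natR (m C k) * (tutteK (suc k) x y * tutteSide s (m ∸ k) x y) ∎
      where
      peel : ∀ xs → sum xs ≡ m ∸ k → term (k ∷ xs) ≈ natR (m C k) * tutteK (suc k) x y * term xs
      peel xs eq = trans (*-congʳ (trans (natR-* ((k ℕ.+ sum xs) C k) (multinomial xs))
        (*-congʳ (reflexive (cong (λ j → natR (j C k)) (≡.trans (cong (k ℕ.+_) eq) (ℕ.m+[n∸m]≡n le)))))))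
          (interchange _ _ _ _)

  -- Induction on the number of parts: both sides satisfy the same binomial recurrence, and their
  -- factors for a single part agree by `tutteK-classicalSum`.
  tutteSide-parkingSum : ∀ s m → tutteSide (suc s) m x y ≈ parkingSum (m ℕ.+ s) m
  tutteSide-parkingSum zero m = begin
    tutteSide 1 m x y ≈⟨ tutteSide-suc 0 m ⟩
    -- A positive number has no composition into zero parts, so only `j` = 0 contributes.
    binomial m (λ k j → tutteK (suc k) x y * tutteSide 0 j x y) ≈⟨ binomial-last m (λ k j → zeroʳ _) ⟩
    tutteK (suc m) x y * tutteSide 0 0 x y
      ≈⟨ *-cong (tutteK-classicalSum m) (trans (+-identityʳ _) (trans (*-identityʳ _) (+-identityʳ 1#))) ⟩
    classicalSum 0 m m * 1# ≈⟨ *-identityʳ _ ⟩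
    classicalSum 0 m m ≈⟨ parkingSum-classical m ⟨
    parkingSum m m ≡⟨ cong (λ n → parkingSum n m) (ℕ.+-identityʳ m) ⟨
    parkingSum (m ℕ.+ 0) m ∎
  tutteSide-parkingSum (suc s) m = begin
    tutteSide (suc (suc s)) m x y ≈⟨ tutteSide-suc (suc s) m ⟩
    binomial m (λ k j → tutteK (suc k) x y * tutteSide (suc s) j x y)
      ≈⟨ binomial-cong m (λ k j _ → *-cong (tutteK-classicalSum k) (tutteSide-parkingSum s j)) ⟩
    binomial m (λ k j → classicalSum 0 k k * parkingSum (j ℕ.+ s) j) ≈⟨ parkingSum-split m s ⟨
    parkingSum (m ℕ.+ suc s) m ∎

  ∑-PF : ∀ m n → ∑ (PF m n) (λ π → pow x (cm n π) * pow y (disp n π)) ≈ parkingSum n m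
  ∑-PF m n = begin
    ∑ (PF m n) (λ π → pow x (cm n π) * pow y (disp n π)) ≈⟨ ∑-filter (is-just ∘ outcome n) (sequences m n) ⟩
    ∑ (sequences m n) term ≡⟨ cong (λ l → ∑ l term) (words-spots m n) ⟩
    ∑ (words m (spots n)) term
      ≈⟨ ∑-congᴬ (All.map (λ {π} pos → reflexive (same π pos)) (words-positive m n)) ⟩
    parkingSum n m ∎
    where
    term : List ℕ → Carrier
    term π = if is-just (outcome n π) then pow x (cm n π) * pow y (disp n π) else 0#
    same : ∀ π → All (1 ≤_) π → term π ≡ blockWeight n π
    same π pos rewrite is-just-outcome n π pos with overflow n 0 π in over
    ... | suc _ = ≡.refl
    ... | zero  = cong₂ (λ a b → pow x a * pow y b) (cm-blocks n π pos over) (disp-delay n π pos over)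

theorem2p6 : ∀ {c ℓ} (R : CommutativeRing c ℓ) (s m : ℕ) → 1 ≤ s →
    (x y : CommutativeRing.Carrier R) →
    CommutativeRing._≈_ R (RingEval.tutteSide R s m x y) (RingEval.parkingSide R s m x y)
theorem2p6 R (suc s) m _ x y = begin
  tutteSide (suc s) m x y ≈⟨ tutteSide-parkingSum s m ⟩
  parkingSum (m ℕ.+ s) m ≡⟨ cong (λ n → parkingSum (n ∸ 1) m) (ℕ.+-suc m s) ⟨
  parkingSum (m ℕ.+ suc s ∸ 1) m ≈⟨ ∑-PF m (m ℕ.+ suc s ∸ 1) ⟨
  parkingSide (suc s) m x y ∎
  where
  open RingEval R
  open Weights R x y
  open BothSides R x y
  open import Relation.Binary.Reasoning.Setoid (CommutativeRing.setoid R)
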